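{- There exists $n_0 \in \mathbb{N}$ such that for every integer $n \geq n_0$ and every integer $k > \frac{8 \log n}{\log\log n}$, there is no $k$-ECTF graph on $n$ vertices. That is, if $f(n)$ denotes the largest integer $k$ for which there exists a $k$-ECTF graph on $n$ vertices, then $f(n) = O\left(\frac{\log n}{\log\log n}\right)$ as $n \to \infty$.
   Context: All graphs are simple and undirected, and $\log$ is the natural logarithm. An embedding of a graph $H$ into a graph $G$ is a graph isomorphism from $H$ to an induced subgraph of $G$. A partial embedding of $H$ into $G$ is a graph isomorphism between an induced subgraph of $H$ (possibly with no vertices) and an induced subgraph of $G$. An embedding $\tilde\theta : H \to G$ extends a partial embedding $\theta$ of $H$ into $G$ if the restriction of $\tilde\theta$ to the domain of $\theta$ equals $\theta$. For a positive integer $k$, a graph $G$ is $k$-ECTF ($k$-existentially complete triangle-free) if $G$ is triangle-free and, for every triangle-free graph $H$ on $k+1$ vertices, every partial embedding of $H$ into $G$ extends to an embedding of $H$ into $G$. -}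

module Defs where

open import Algebra.Bundles using (CommutativeRing)
import Algebra.Properties.Semiring.Exp as Exp
open import Data.Empty using (⊥; ⊥-elim)
open import Data.Fin using (Fin)
open import Data.Integer as ℤ using (+_; -[1+_])
import Data.Integer.Properties as ℤₚ
open import Data.Maybe using (Maybe; just)
open import Data.Nat as ℕ using (ℕ; zero; suc)
import Data.Nat.Properties as ℕₚ
open import Data.Product using (Σ; ∃; ∃₂; ∃-syntax; _×_; _,_; proj₁; proj₂)
open import Data.Rational
open import Data.Rational.Properties
open import Data.Rational.Solver using (module +-*-Solver)
open import Data.Rational.Unnormalised as ℚᵘ using (ℚᵘ; mkℚᵘ)
import Data.Rational.Unnormalised.Properties as ℚᵘₚ
open import Data.Sum using (_⊎_; inj₁; inj₂; [_,_]′)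
open import Function.Bundles using (_⇔_)
open import Level using (0ℓ)
open import Relation.Binary using (Rel; Symmetric; Irreflexive; Decidable; tri<; tri≈; tri>)
open import Relation.Binary.PropositionalEquality
open import Relation.Nullary using (¬_; yes; no)
open import Relation.Nullary.Decidable using (from-yes)

open Exp (CommutativeRing.semiring +-*-commutativeRing) public
  using (_^_; ^-assocʳ)
open +-*-Solver using (solve; con; _:=_; _:+_; _:*_; _:-_; :-_)

ι : ℕ → ℚ
ι n = + n / 1

1/1+_ : ℕ → ℚ
1/1+ j = + 1 / suc j

private
  variable
    a b c d e p q r : ℚ

abstract
  by : 0ℚ < d → q ≡ p + d → p < q
  by {d} {q} {p} 0<d eq =
    subst₂ _<_ (+-identityʳ p) (sym eq) (+-monoʳ-< p 0<d)

  by≤ : 0ℚ ≤ d → q ≡ p + d → p ≤ q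
  by≤ {d} {q} {p} 0≤d eq =
    subst₂ _≤_ (+-identityʳ p) (sym eq) (+-monoʳ-≤ p 0≤d)

  diff : p < q → 0ℚ < q - p
  diff {p} {q} h = subst (_< q - p) (+-inverseʳ p) (+-monoˡ-< (- p) h)

  diff≤ : p ≤ q → 0ℚ ≤ q - p
  diff≤ {p} {q} h = subst (_≤ q - p) (+-inverseʳ p) (+-monoˡ-≤ (- p) h)

  *-mono : 0ℚ < r → p < q → r * p < r * q
  *-mono {r} h = *-monoʳ-<-pos r {{positive h}}

  *-mono′ : 0ℚ < r → p < q → p * r < q * r
  *-mono′ {r} h = *-monoˡ-<-pos r {{positive h}}

  *-mono≤ : 0ℚ ≤ r → p ≤ q → r * p ≤ r * q
  *-mono≤ {r} h = *-monoˡ-≤-nonNeg r {{nonNegative h}}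

  *-mono≤′ : 0ℚ ≤ r → p ≤ q → p * r ≤ q * r
  *-mono≤′ {r} h = *-monoʳ-≤-nonNeg r {{nonNegative h}}

  0<* : 0ℚ < p → 0ℚ < q → 0ℚ < p * q
  0<* {p} {q} 0<p 0<q = subst (_< p * q) (*-zeroʳ p) (*-mono 0<p 0<q)

  0≤* : 0ℚ ≤ p → 0ℚ ≤ q → 0ℚ ≤ p * q
  0≤* {p} {q} 0≤p 0≤q = subst (_≤ p * q) (*-zeroʳ p) (*-mono≤ 0≤p 0≤q)

  0<+ : 0ℚ < p → 0ℚ < q → 0ℚ < p + q
  0<+ = +-mono-<

  0≤+ : 0ℚ ≤ p → 0ℚ ≤ q → 0ℚ ≤ p + q
  0≤+ = +-mono-≤

  0<1 : 0ℚ < 1ℚ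
  0<1 = from-yes (0ℚ <? 1ℚ)

  inverse : 0ℚ < p → ∃[ r ] 0ℚ < r × p * r ≡ 1ℚ
  inverse {p} 0<p = 1/ p , positive⁻¹ (1/ p) {{1/pos⇒pos p}} , *-inverseʳ p
    where instance
      p⁺ : Positive p
      p⁺ = positive 0<p
      p≢0 : NonZero p
      p≢0 = pos⇒nonZero p

  a*b*b⁻¹ : ∀ a → b * c ≡ 1ℚ → (a * c) * b ≡ a
  a*b*b⁻¹ {b} {c} a bc = begin
    (a * c) * b ≡⟨ solve 3 (λ a b c → (a :* c) :* b := a :* (b :* c)) refl a b c ⟩
    a * (b * c) ≡⟨ cong (a *_) bc ⟩
    a * 1ℚ      ≡⟨ *-identityʳ a ⟩
    a           ∎
    where open ≡-Reasoning

  ≤-∣∣ : ∀ p → p ≤ ∣ p ∣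
  ≤-∣∣ p with ≤-total 0ℚ p
  ... | inj₁ 0≤p = ≤-reflexive (sym (0≤p⇒∣p∣≡p 0≤p))
  ... | inj₂ p≤0 = ≤-trans p≤0 (0≤∣p∣ p)

  -∣∣≤ : ∀ p → - ∣ p ∣ ≤ p
  -∣∣≤ p = subst (- ∣ p ∣ ≤_) (solve 1 (λ p → :- (:- p) := p) refl p)
    (neg-antimono-≤ (subst (- p ≤_) (∣-p∣≡∣p∣ p) (≤-∣∣ (- p))))

  toℚᵘ-ι : ∀ n → toℚᵘ (ι n) ℚᵘ.≃ mkℚᵘ (+ n) 0
  toℚᵘ-ι n = toℚᵘ-fromℚᵘ (mkℚᵘ (+ n) 0)

  ι-suc : ∀ n → ι (suc n) ≡ 1ℚ + ι n
  ι-suc n = toℚᵘ-injective (begin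
    toℚᵘ (ι (suc n))              ≈⟨ toℚᵘ-ι (suc n) ⟩
    mkℚᵘ (+ suc n) 0              ≈⟨ ℚᵘ.*≡* (cong (ℤ._* (+ 1)) (cong (λ z → (+ 1) ℤ.+ z) (sym (ℤₚ.*-identityʳ (+ n))))) ⟩
    toℚᵘ 1ℚ ℚᵘ.+ mkℚᵘ (+ n) 0     ≈⟨ ℚᵘₚ.+-congʳ (toℚᵘ 1ℚ) (toℚᵘ-ι n) ⟨
    toℚᵘ 1ℚ ℚᵘ.+ toℚᵘ (ι n)       ≈⟨ toℚᵘ-homo-+ 1ℚ (ι n) ⟨
    toℚᵘ (1ℚ + ι n)               ∎)
    where open ℚᵘₚ.≃-Reasoning

  ι-0≤ : ∀ n → 0ℚ ≤ ι n
  ι-0≤ zero    = ≤-refl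
  ι-0≤ (suc n) = subst (0ℚ ≤_) (sym (ι-suc n)) (0≤+ (<⇒≤ 0<1) (ι-0≤ n))

  ι-0< : ∀ j → 0ℚ < ι (suc j)
  ι-0< j = subst (0ℚ <_) (sym (ι-suc j)) (+-mono-<-≤ 0<1 (ι-0≤ j))

  ι-mono : ∀ {m n} → m ℕ.≤ n → ι m ≤ ι n
  ι-mono {n = n} ℕ.z≤n = ι-0≤ n
  ι-mono {suc m} {suc n} (ℕ.s≤s h) = subst₂ _≤_ (sym (ι-suc m)) (sym (ι-suc n))
    (+-monoʳ-≤ 1ℚ (ι-mono h))

  ι*1/1+ : ∀ j → ι (suc j) * (1/1+ j) ≡ 1ℚ
  ι*1/1+ j = toℚᵘ-injective (begin
    toℚᵘ (ι (suc j) * (1/1+ j))           ≈⟨ toℚᵘ-homo-* (ι (suc j)) (1/1+ j) ⟩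
    toℚᵘ (ι (suc j)) ℚᵘ.* toℚᵘ (1/1+ j)   ≈⟨ ℚᵘₚ.*-cong (toℚᵘ-ι (suc j)) (toℚᵘ-fromℚᵘ (mkℚᵘ (+ 1) j)) ⟩
    mkℚᵘ (+ suc j) 0 ℚᵘ.* mkℚᵘ (+ 1) j    ≈⟨ ℚᵘ.*≡* (trans (cong (ℤ._* (+ 1)) (ℤₚ.*-comm (+ suc j) (+ 1))) (ℤₚ.*-comm (+ 1 ℤ.* + suc j) (+ 1))) ⟩
    toℚᵘ 1ℚ                               ∎)
    where open ℚᵘₚ.≃-Reasoning

  0<1/1+ : ∀ j → 0ℚ < 1/1+ j
  0<1/1+ j = positive⁻¹ (1/1+ j) {{normalize-pos 1 (suc j)}}

  archimedean : ∀ p → ∃[ j ] p < ι (suc j)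
  archimedean p@(mkℚ n d _) = ℤ.∣ n ∣ , toℚᵘ-cancel-< (ℚᵘₚ.<-respʳ-≃ (ℚᵘₚ.≃-sym (toℚᵘ-ι (suc ℤ.∣ n ∣))) (ℚᵘ.*<* (lemma n)))
    where
    lemma : ∀ n → n ℤ.* + 1 ℤ.< + suc ℤ.∣ n ∣ ℤ.* + suc d
    lemma (+ m)    = subst (ℤ._< + suc m ℤ.* + suc d) (sym (ℤₚ.*-identityʳ (+ m)))
      (ℤ.+<+ (ℕₚ.<-≤-trans (ℕₚ.n<1+n m) (ℕₚ.m≤m*n (suc m) (suc d))))
    lemma -[1+ m ] = subst (ℤ._< + suc (suc m) ℤ.* + suc d) (sym (ℤₚ.*-identityʳ -[1+ m ])) ℤ.-<+

  ^-0≤ : ∀ n → 0ℚ ≤ a → 0ℚ ≤ a ^ n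
  ^-0≤ zero    _ = <⇒≤ 0<1
  ^-0≤ (suc n) h = 0≤* h (^-0≤ n h)

  ^-0< : ∀ n → 0ℚ < a → 0ℚ < a ^ n
  ^-0< zero    _ = 0<1
  ^-0< (suc n) h = 0<* h (^-0< n h)

  ^-mono : ∀ n → 0ℚ ≤ a → a ≤ b → a ^ n ≤ b ^ n
  ^-mono zero    _ _ = ≤-refl
  ^-mono (suc n) h l = ≤-trans (*-mono≤ h (^-mono n h l)) (*-mono≤′ (^-0≤ n (≤-trans h l)) l)

  1^ : ∀ n → 1ℚ ^ n ≡ 1ℚ
  1^ zero    = refl
  1^ (suc n) = trans (*-identityˡ _) (1^ n)

  ^-≤1 : ∀ n → 0ℚ ≤ a → a ≤ 1ℚ → a ^ n ≤ 1ℚ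
  ^-≤1 {a} n h l = subst (a ^ n ≤_) (1^ n) (^-mono n h l)

  1≤^ : ∀ n → 1ℚ ≤ a → 1ℚ ≤ a ^ n
  1≤^ {a} n l = subst (_≤ a ^ n) (1^ n) (^-mono n (<⇒≤ 0<1) l)

  1<^ : ∀ n → 1ℚ < a → 1ℚ < a ^ suc n
  1<^ {a} n l = <-≤-trans l (subst (_≤ a ^ suc n) (*-identityʳ a)
    (*-mono≤ (<⇒≤ (<-trans 0<1 l)) (1≤^ n (<⇒≤ l))))

  ^-distrib-* : ∀ a b n → (a * b) ^ n ≡ a ^ n * b ^ n
  ^-distrib-* a b zero    = refl
  ^-distrib-* a b (suc n) = trans (cong ((a * b) *_) (^-distrib-* a b n))
    (solve 4 (λ a b x y → (a :* b) :* (x :* y) := (a :* x) :* (b :* y)) refl a b (a ^ n) (b ^ n))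

  square : ∀ t → 0ℚ ≤ t * t
  square t with ≤-total 0ℚ t
  ... | inj₁ h = 0≤* h h
  ... | inj₂ h = subst (0ℚ ≤_) (solve 1 (λ t → (con 0ℚ :- t) :* (con 0ℚ :- t) := t :* t) refl t)
                   (0≤* (diff≤ h) (diff≤ h))

  bernoulli : ∀ n t → 0ℚ ≤ 1ℚ + t → 1ℚ + ι n * t ≤ (1ℚ + t) ^ n
  bernoulli zero    t h = ≤-reflexive (solve 1 (λ t → con 1ℚ :+ con 0ℚ :* t := con 1ℚ) refl t)
  bernoulli (suc n) t h = ≤-trans
    (by≤ (0≤* (ι-0≤ n) (square t)) (trans
      (solve 2 (λ t x → (con 1ℚ :+ t) :* (con 1ℚ :+ x :* t) := (con 1ℚ :+ (con 1ℚ :+ x) :* t) :+ x :* (t :* t)) refl t (ι n))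
      (cong (λ z → (1ℚ + z * t) + ι n * (t * t)) (sym (ι-suc n)))))
    (*-mono≤ h (bernoulli n t h))

  ⊔-lub-< : p < r → q < r → p ⊔ q < r
  ⊔-lub-< {p} {r} {q} p<r q<r with ≤-total p q
  ... | inj₁ h = subst (_< r) (sym (p≤q⇒p⊔q≡q h)) q<r
  ... | inj₂ h = subst (_< r) (sym (p≥q⇒p⊔q≡p h)) p<r

  ^-open : ∀ n → 0ℚ < a → c < a ^ n → ∃[ b ] 0ℚ < b × b < a × c < b ^ n
  ^-open-step : ∀ n {w v} → 0ℚ < w → a * w ≡ 1ℚ → 0ℚ < b → b < a → c * w < b ^ n →
                0ℚ < v → b ^ n * v ≡ 1ℚ → ∃[ e ] 0ℚ < e × e < a × c < e ^ suc n

  ^-open zero 0<a l = let (b , 0<b , b<a) = <-dense 0<a in b , 0<b , b<a , l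
  ^-open {a} {c} (suc n) 0<a l =
    let (w , 0<w , aw) = inverse 0<a
        (b , 0<b , b<a , cw<b^n) = ^-open n 0<a
          (subst (c * w <_) (trans (solve 3 (λ a x w → (a :* x) :* w := (x :* w) :* a) refl a (a ^ n) w) (a*b*b⁻¹ (a ^ n) aw))
             (*-mono′ 0<w l))
        (v , 0<v , bv) = inverse (^-0< n 0<b)
    in ^-open-step n 0<w aw 0<b b<a cw<b^n 0<v bv

  ^-open-step {a} {b} {c} n {w} {v} 0<w aw 0<b b<a cw<b^n 0<v bv =
    t , 0<t , t<a , c<t^
    where
    x : ℚ
    x = b ^ n
    c<ax : c < a * x
    c<ax = subst₂ _<_ (a*b*b⁻¹ c aw) (*-comm x a) (*-mono′ (<-trans 0<b b<a) cw<b^n)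
    cv<a : c * v < a
    cv<a = subst (c * v <_) (a*b*b⁻¹′ a bv) (*-mono′ 0<v c<ax)
      where
      a*b*b⁻¹′ : ∀ a → x * v ≡ 1ℚ → (a * x) * v ≡ a
      a*b*b⁻¹′ a xv = trans (*-assoc a x v) (trans (cong (a *_) xv) (*-identityʳ a))
    between : ∃[ t ] (c * v ⊔ b) < t × t < a
    between = <-dense (⊔-lub-< cv<a b<a)
    t : ℚ
    t = proj₁ between
    b<t : b < t
    b<t = ≤-<-trans (p≤q⊔p (c * v) b) (proj₁ (proj₂ between))
    cv<t : c * v < t
    cv<t = ≤-<-trans (p≤p⊔q (c * v) b) (proj₁ (proj₂ between))
    t<a : t < a
    t<a = proj₂ (proj₂ between)
    0<t : 0ℚ < t
    0<t = <-trans 0<b b<t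
    c<t^ : c < t ^ suc n
    c<t^ = <-≤-trans (subst (_< t * x) (a*b*b⁻¹ c bv) (*-mono′ (^-0< n 0<b) cv<t))
             (*-mono≤ (<⇒≤ 0<t) (^-mono n (<⇒≤ 0<b) (<⇒≤ b<t)))

record ℝ : Set₁ where
  field
    lower upper     : ℚ → Set
    lower-inhabited : ∃ lower
    upper-inhabited : ∃ upper
    lower-closed    : ∀ {p q} → p < q → lower q → lower p
    upper-closed    : ∀ {p q} → p < q → upper p → upper q
    lower-rounded   : ∀ {p} → lower p → ∃[ q ] p < q × lower q
    upper-rounded   : ∀ {q} → upper q → ∃[ p ] p < q × upper p
    disjoint        : ∀ {q} → lower q → upper q → ⊥
    located         : ∀ {p q} → p < q → lower p ⊎ upper q

open ℝ public

infix 4 _<ᴿ_ _≤ᴿ_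

_<ᴿ_ : ℝ → ℝ → Set
x <ᴿ y = ∃[ q ] upper x q × lower y q

_≤ᴿ_ : ℝ → ℝ → Set
x ≤ᴿ y = ¬ (y <ᴿ x)

fromℚ : ℚ → ℝ
fromℚ c .lower q = q < c
fromℚ c .upper q = c < q
fromℚ c .lower-inhabited = c - 1ℚ , by 0<1 (solve 1 (λ c → c := (c :- con 1ℚ) :+ con 1ℚ) refl c)
fromℚ c .upper-inhabited = c + 1ℚ , by 0<1 refl
fromℚ c .lower-closed = <-trans
fromℚ c .upper-closed h l = <-trans l h
fromℚ c .lower-rounded = <-dense
fromℚ c .upper-rounded h = let (p , c<p , p<q) = <-dense h in p , p<q , c<p
fromℚ c .disjoint h l = <-asym h l
fromℚ c .located {p} {q} p<q with p <? c
... | yes p<c = inj₁ p<c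
... | no  p≮c = inj₂ (≤-<-trans (≮⇒≥ p≮c) p<q)

fromℕ : ℕ → ℝ
fromℕ n = fromℚ (ι n)

abstract
  lower-closed≤ : ∀ (x : ℝ) → p ≤ q → lower x q → lower x p
  lower-closed≤ {p} {q} x h l with <-cmp p q
  ... | tri< p<q _ _ = x .lower-closed p<q l
  ... | tri≈ _ refl _ = l
  ... | tri> _ _ q<p = ⊥-elim (<-irrefl refl (<-≤-trans q<p h))

  upper-closed≤ : ∀ (x : ℝ) → p ≤ q → upper x p → upper x q
  upper-closed≤ {p} {q} x h l with <-cmp p q
  ... | tri< p<q _ _ = x .upper-closed p<q l
  ... | tri≈ _ refl _ = l
  ... | tri> _ _ q<p = ⊥-elim (<-irrefl refl (<-≤-trans q<p h))

  lower<upper : ∀ (x : ℝ) → lower x p → upper x q → p < q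
  lower<upper {p} {q} x l u with <-cmp p q
  ... | tri< p<q _ _ = p<q
  ... | tri≈ _ refl _ = ⊥-elim (x .disjoint l u)
  ... | tri> _ _ q<p = ⊥-elim (x .disjoint l (x .upper-closed q<p u))

  approximate-go : ∀ (y : ℝ) → 0ℚ < d → ∀ n b → lower y b → upper y (b + ι n * d) →
                   ∃[ b′ ] b ≤ b′ × lower y b′ × upper y (b′ + (d + d))
  approximate-go {d} y 0<d zero b lb u = ⊥-elim (y .disjoint lb
    (subst (upper y) (solve 2 (λ b d → b :+ con 0ℚ :* d := b) refl b d) u))
  approximate-go {d} y 0<d (suc n) b lb u = step (y .located
    (by 0<d (solve 2 (λ b d → b :+ (d :+ d) := (b :+ d) :+ d) refl b d)))
    where
    step : lower y (b + d) ⊎ upper y (b + (d + d)) →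
           ∃[ b′ ] b ≤ b′ × lower y b′ × upper y (b′ + (d + d))
    step (inj₂ u′) = b , ≤-refl , lb , u′
    step (inj₁ l′) =
      let (b′ , h , l″ , u″) = approximate-go y 0<d n (b + d) l′
            (subst (upper y) (trans (cong (λ z → b + z * d) (ι-suc n))
              (solve 3 (λ b d x → b :+ (con 1ℚ :+ x) :* d := (b :+ d) :+ x :* d) refl b d (ι n))) u)
      in b′ , ≤-trans (<⇒≤ (by 0<d refl)) h , l″ , u″

  approximate-bound : ∀ b c d w x → d * w ≡ 1ℚ → b + x * d ≡ c + (x - (c - b) * w) * d
  approximate-bound b c d w x dw = sym (begin
    c + (x - (c - b) * w) * d
      ≡⟨ solve 5 (λ b c d w x → c :+ (x :- (c :- b) :* w) :* d := c :+ (x :* d :- ((c :- b) :* w) :* d)) refl b c d w x ⟩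
    c + (x * d - ((c - b) * w) * d)
      ≡⟨ cong (λ z → c + (x * d - z)) (a*b*b⁻¹ (c - b) dw) ⟩
    c + (x * d - (c - b))
      ≡⟨ solve 3 (λ b c x → c :+ (x :- (c :- b)) := b :+ x) refl b c (x * d) ⟩
    b + x * d ∎)
    where open ≡-Reasoning

  approximate : ∀ (y : ℝ) → 0ℚ < d → lower y b →
                ∃[ b′ ] b ≤ b′ × lower y b′ × upper y (b′ + (d + d))
  approximate {d} {b} y 0<d lb =
    let (c , uc)       = y .upper-inhabited
        (w , 0<w , dw) = inverse 0<d
        (j , <j)       = archimedean ((c - b) * w)
    in approximate-go y 0<d (suc j) b lb
         (upper-closed≤ y (by≤ (<⇒≤ (0<* (diff <j) 0<d)) (approximate-bound b c d w (ι (suc j)) dw)) uc)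

infixr 8 _·_

_·_ : (c : ℚ) .{{_ : Positive c}} → ℝ → ℝ
_·_ c {{c⁺}} x = record
  { lower = λ q → ∃[ a ] lower x a × q ≡ c * a
  ; upper = λ q → ∃[ a ] upper x a × q ≡ c * a
  ; lower-inhabited = let (a , l) = x .lower-inhabited in c * a , a , l , refl
  ; upper-inhabited = let (a , u) = x .upper-inhabited in c * a , a , u , refl
  ; lower-closed = λ { {p} p<q (a , l , refl) → w * p , x .lower-closed (cancel p<q) l , sym (cw p) }
  ; upper-closed = λ { {q = q} p<q (a , u , refl) → w * q , x .upper-closed (cancel′ p<q) u , sym (cw q) }
  ; lower-rounded = λ { (a , l , refl) → let (b , a<b , lb) = x .lower-rounded l in c * b , *-mono 0<c a<b , b , lb , refl }
  ; upper-rounded = λ { (a , u , refl) → let (b , b<a , ub) = x .upper-rounded u in c * b , *-mono 0<c b<a , b , ub , refl }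
  ; disjoint = λ { (a , l , refl) (b , u , eq) → <-irrefl eq (*-mono 0<c (lower<upper x l u)) }
  ; located = λ {p} {q} p<q → loc p q (x .located (*-mono 0<w p<q))
  }
  where
  0<c : 0ℚ < c
  0<c = positive⁻¹ c
  w = proj₁ (inverse 0<c)
  0<w : 0ℚ < w
  0<w = proj₁ (proj₂ (inverse 0<c))
  cw : ∀ p → c * (w * p) ≡ p
  cw p = trans (solve 3 (λ c w p → c :* (w :* p) := (p :* w) :* c) refl c w p) (a*b*b⁻¹ p (proj₂ (proj₂ (inverse 0<c))))
  wc : ∀ p → w * (c * p) ≡ p
  wc p = trans (solve 3 (λ c w p → w :* (c :* p) := (p :* w) :* c) refl c w p) (a*b*b⁻¹ p (proj₂ (proj₂ (inverse 0<c))))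
  cancel : p < c * a → w * p < a
  cancel {p} {a} h = subst (w * p <_) (wc a) (*-mono 0<w h)
  cancel′ : c * a < p → a < w * p
  cancel′ {a} {p} h = subst (_< w * p) (wc a) (*-mono 0<w h)
  loc : ∀ p q → lower x (w * p) ⊎ upper x (w * q) →
        (∃[ a ] lower x a × p ≡ c * a) ⊎ (∃[ a ] upper x a × q ≡ c * a)
  loc p q (inj₁ l) = inj₁ (w * p , l , sym (cw p))
  loc p q (inj₂ u) = inj₂ (w * q , u , sym (cw q))

abstract
  slope-below : 0ℚ < b → b ≤ c → ∀ a → ∃[ r ] r * b ≤ a × r * c ≤ a
  slope-below {b} {c} 0<b b≤c a =
    let (w , 0<w , bw) = inverse 0<b in - ∣ a ∣ * w , lemma w 0<w bw
    where
    lemma : ∀ w → 0ℚ < w → b * w ≡ 1ℚ → (- ∣ a ∣ * w) * b ≤ a × (- ∣ a ∣ * w) * c ≤ a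
    lemma w 0<w bw = at-b , ≤-trans (by≤ (0≤* (0≤* (0≤∣p∣ a) (<⇒≤ 0<w)) (diff≤ b≤c))
        (solve 4 (λ a w b c → (:- a :* w) :* b := (:- a :* w) :* c :+ (a :* w) :* (c :- b)) refl ∣ a ∣ w b c)) at-b
      where
      at-b : (- ∣ a ∣ * w) * b ≤ a
      at-b = ≤-trans (≤-reflexive (a*b*b⁻¹ (- ∣ a ∣) bw)) (-∣∣≤ a)

  slope-above : 0ℚ < b → b ≤ c → ∀ a → ∃[ r ] a ≤ r * b × a ≤ r * c
  slope-above {b} {c} 0<b b≤c a =
    let (w , 0<w , bw) = inverse 0<b in ∣ a ∣ * w , lemma w 0<w bw
    where
    lemma : ∀ w → 0ℚ < w → b * w ≡ 1ℚ → a ≤ (∣ a ∣ * w) * b × a ≤ (∣ a ∣ * w) * c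
    lemma w 0<w bw = at-b , ≤-trans at-b (*-mono≤ (0≤* (0≤∣p∣ a) (<⇒≤ 0<w)) b≤c)
      where
      at-b : a ≤ (∣ a ∣ * w) * b
      at-b = ≤-trans (≤-∣∣ a) (≤-reflexive (sym (a*b*b⁻¹ ∣ a ∣ bw)))

  quot : 0ℚ < b → p * b < a → ∃[ r ] p < r × r * b ≡ a
  quot {b} {p} {a} 0<b h = let (v , 0<v , bv) = inverse 0<b in a * v
    , subst (_< a * v) (trans (solve 3 (λ p b v → (p :* b) :* v := (p :* v) :* b) refl p b v) (a*b*b⁻¹ p bv)) (*-mono′ 0<v h)
    , a*b*b⁻¹ a bv

  quot′ : 0ℚ < b → a < p * b → ∃[ r ] r < p × r * b ≡ a
  quot′ {b} {a} {p} 0<b h = let (v , 0<v , bv) = inverse 0<b in a * v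
    , subst (a * v <_) (trans (solve 3 (λ p b v → (p :* b) :* v := (p :* v) :* b) refl p b v) (a*b*b⁻¹ p bv)) (*-mono′ 0<v h)
    , a*b*b⁻¹ a bv

-- The rationals q with q·y ∈ P, for P a cut of a real. Cuts are convex, so it is
-- enough that P holds at both ends q·b, q·c of an interval around q·y; this
-- needs no case distinction on the sign of q.

Divide : ℝ → (ℚ → Set) → ℚ → Set
Divide y P q = ∃₂ λ b c → 0ℚ < b × lower y b × upper y c × P (q * b) × P (q * c)

abstract
  *-round : 0ℚ < b → 0ℚ < c → p * b < q → p * c < r →
            ∃[ s ] p < s × s * b ≤ q × s * c ≤ r
  *-round {b} {c} {p} {q} {r} 0<b 0<c h k =
    let (s , p<s , sb≡q) = quot {p = p} 0<b h
        (t , p<t , tc≡r) = quot {p = p} 0<c k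
    in choose s t p<s p<t sb≡q tc≡r
    where
    choose : ∀ s t → p < s → p < t → s * b ≡ q → t * c ≡ r →
             ∃[ s ] p < s × s * b ≤ q × s * c ≤ r
    choose s t p<s p<t sb≡q tc≡r with ≤-total s t
    ... | inj₁ s≤t = s , p<s , ≤-reflexive sb≡q , ≤-trans (*-mono≤′ {r = c} (<⇒≤ 0<c) s≤t) (≤-reflexive tc≡r)
    ... | inj₂ t≤s = t , p<t , ≤-trans (*-mono≤′ {r = b} (<⇒≤ 0<b) t≤s) (≤-reflexive sb≡q) , ≤-reflexive tc≡r

  *-round′ : 0ℚ < b → 0ℚ < c → q < p * b → r < p * c →
             ∃[ s ] s < p × q ≤ s * b × r ≤ s * c
  *-round′ {b} {c} {q} {p} {r} 0<b 0<c h k =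
    let (s , s<p , sb≡q) = quot′ {p = p} 0<b h
        (t , t<p , tc≡r) = quot′ {p = p} 0<c k
    in choose s t s<p t<p sb≡q tc≡r
    where
    choose : ∀ s t → s < p → t < p → s * b ≡ q → t * c ≡ r →
             ∃[ s ] s < p × q ≤ s * b × r ≤ s * c
    choose s t s<p t<p sb≡q tc≡r with ≤-total s t
    ... | inj₂ t≤s = s , s<p , ≤-reflexive (sym sb≡q) , ≤-trans (≤-reflexive (sym tc≡r)) (*-mono≤′ {r = c} (<⇒≤ 0<c) t≤s)
    ... | inj₁ s≤t = t , t<p , ≤-trans (≤-reflexive (sym sb≡q)) (*-mono≤′ {r = b} (<⇒≤ 0<b) s≤t) , ≤-reflexive (sym tc≡r)

  Divide-lower-rounded : ∀ (x y : ℝ) → Divide y (lower x) p → ∃[ r ] p < r × Divide y (lower x) r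
  Divide-lower-rounded {p} x y (b , c , 0<b , lb , uc , h , k) =
    let (a₁ , l₁ , h₁)    = x .lower-rounded h
        (a₂ , l₂ , h₂)    = x .lower-rounded k
        (r , p<r , i , j) = *-round {b} {c} {p} 0<b (<-trans 0<b (lower<upper y lb uc)) l₁ l₂
    in r , p<r , b , c , 0<b , lb , uc , lower-closed≤ x i h₁ , lower-closed≤ x j h₂

  Divide-upper-rounded : ∀ (x y : ℝ) → Divide y (upper x) q → ∃[ p ] p < q × Divide y (upper x) p
  Divide-upper-rounded {q} x y (b , c , 0<b , lb , uc , h , k) =
    let (a₁ , l₁ , h₁)    = x .upper-rounded h
        (a₂ , l₂ , h₂)    = x .upper-rounded k
        (r , r<q , i , j) = *-round′ {b} {c} {p = q} 0<b (<-trans 0<b (lower<upper y lb uc)) l₁ l₂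
    in r , r<q , b , c , 0<b , lb , uc , upper-closed≤ x i h₁ , upper-closed≤ x j h₂

  convex-lower : ∀ (x : ℝ) q → b ≤ d → d ≤ c → lower x (q * b) → lower x (q * c) → lower x (q * d)
  convex-lower x q b≤d d≤c h k =
    [ (λ 0≤q → lower-closed≤ x (*-mono≤ 0≤q d≤c) k)
    , (λ q≤0 → lower-closed≤ x (*-monoˡ-≤-nonPos q {{nonPositive q≤0}} b≤d) h)
    ]′ (≤-total 0ℚ q)

  convex-upper : ∀ (x : ℝ) q → b ≤ d → d ≤ c → upper x (q * b) → upper x (q * c) → upper x (q * d)
  convex-upper x q b≤d d≤c h k =
    [ (λ 0≤q → upper-closed≤ x (*-mono≤ 0≤q b≤d) h)
    , (λ q≤0 → upper-closed≤ x (*-monoˡ-≤-nonPos q {{nonPositive q≤0}} d≤c) k)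
    ]′ (≤-total 0ℚ q)

  Divide-disjoint : ∀ (x y : ℝ) → Divide y (lower x) q → Divide y (upper x) q → ⊥
  Divide-disjoint {q} x y (b , c , 0<b , lb , uc , h , k) (b′ , c′ , 0<b′ , lb′ , uc′ , h′ , k′) =
    [ (λ b≤b′ → x .disjoint (convex-lower x q b≤b′ (<⇒≤ (lower<upper y lb′ uc)) h k) h′)
    , (λ b′≤b → x .disjoint h (convex-upper x q b′≤b (<⇒≤ (lower<upper y lb uc′)) h′ k′))
    ]′ (≤-total b b′)

  -- Given b < y < b + e with e small enough, p·b and p·(b + e) are both below
  -- q·b and q·(b + e), and x is located between the two pairs.
  Divide-located-at : ∀ (x y : ℝ) {b₀} → p < q → 0ℚ < e → 0ℚ < b₀ →
                      e * (1ℚ + (∣ p ∣ + ∣ q ∣)) < (q - p) * b₀ →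
                      b₀ ≤ b → lower y b → upper y (b + e) →
                      Divide y (lower x) p ⊎ Divide y (upper x) q
  Divide-located-at {p} {q} {e} {b} x y {b₀} p<q 0<e 0<b₀ eM<b₀ b₀≤b lb uc = result
    where
    0<b : 0ℚ < b
    0<b = <-≤-trans 0<b₀ b₀≤b
    0<b+e : 0ℚ < b + e
    0<b+e = 0<+ 0<b 0<e
    eM< : e * (1ℚ + (∣ p ∣ + ∣ q ∣)) < (q - p) * b
    eM< = <-≤-trans eM<b₀ (*-mono≤ (<⇒≤ (diff p<q)) b₀≤b)
    ep< : e * p < (q - p) * b
    ep< = ≤-<-trans (*-mono≤ (<⇒≤ 0<e) (≤-trans (≤-∣∣ p) (by≤ (0≤+ (<⇒≤ 0<1) (0≤∣p∣ q))
      (solve 2 (λ x y → con 1ℚ :+ (x :+ y) := x :+ (con 1ℚ :+ y)) refl ∣ p ∣ ∣ q ∣)))) eM<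
    -eq< : e * (- q) < (q - p) * b
    -eq< = ≤-<-trans (*-mono≤ (<⇒≤ 0<e) (≤-trans (subst (- q ≤_) (∣-p∣≡∣p∣ q) (≤-∣∣ (- q))) (by≤ (0≤+ (<⇒≤ 0<1) (0≤∣p∣ p))
      (solve 2 (λ x y → con 1ℚ :+ (x :+ y) := y :+ (con 1ℚ :+ x)) refl ∣ p ∣ ∣ q ∣)))) eM<
    pc<qb : p * (b + e) < q * b
    pc<qb = by (diff ep<) (solve 4 (λ p q b e → q :* b := p :* (b :+ e) :+ ((q :- p) :* b :- e :* p)) refl p q b e)
    pb<qc : p * b < q * (b + e)
    pb<qc = by (diff -eq<) (solve 4 (λ p q b e → q :* (b :+ e) := p :* b :+ ((q :- p) :* b :- e :* (:- q))) refl p q b e)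
    split : ∀ {a a′} → p * b ≤ a → p * (b + e) ≤ a → a′ ≤ q * b → a′ ≤ q * (b + e) → a < a′ →
            Divide y (lower x) p ⊎ Divide y (upper x) q
    split h k h′ k′ a<a′ =
      [ (λ l → inj₁ (b , b + e , 0<b , lb , uc , lower-closed≤ x h l , lower-closed≤ x k l))
      , (λ u → inj₂ (b , b + e , 0<b , lb , uc , upper-closed≤ x h′ u , upper-closed≤ x k′ u))
      ]′ (x .located a<a′)
    result : Divide y (lower x) p ⊎ Divide y (upper x) q
    result with ≤-total (p * b) (p * (b + e)) | ≤-total (q * b) (q * (b + e))
    ... | inj₁ h | inj₁ k = split h ≤-refl ≤-refl k pc<qb
    ... | inj₁ h | inj₂ k = split h ≤-refl k ≤-refl (*-mono′ 0<b+e p<q)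
    ... | inj₂ h | inj₁ k = split ≤-refl h ≤-refl k (*-mono′ 0<b p<q)
    ... | inj₂ h | inj₂ k = split ≤-refl h k ≤-refl pb<qc

  Divide-located : ∀ (x y : ℝ) → 0ℚ < b → lower y b → p < q →
                   Divide y (lower x) p ⊎ Divide y (upper x) q
  Divide-located {b₀} {p} {q} x y 0<b₀ lb₀ p<q =
    let 0<M                  = +-mono-<-≤ 0<1 (0≤+ (0≤∣p∣ p) (0≤∣p∣ q))
        (v , 0<v , Mv)       = inverse 0<M
        (e , 0<e , e<)       = <-dense (0<* (0<* (diff p<q) 0<b₀) 0<v)
        (b , b₀≤b , lb , uc) = approximate y (0<* (from-yes (0ℚ <? ½)) 0<e) lb₀
    in Divide-located-at x y p<q 0<e 0<b₀
         (subst (e * (1ℚ + (∣ p ∣ + ∣ q ∣)) <_) (a*b*b⁻¹ ((q - p) * b₀) Mv) (*-mono′ 0<M e<))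
         b₀≤b lb
         (subst (λ z → upper y (b + z)) (solve 1 (λ e → con ½ :* e :+ con ½ :* e := e) refl e) uc)

infixl 7 _÷ᴿ_⟨_⟩

_÷ᴿ_⟨_⟩ : (x y : ℝ) → fromℕ 0 <ᴿ y → ℝ
x ÷ᴿ y ⟨ b₀ , 0<b₀ , lb₀ ⟩ = record
  { lower = Divide y (lower x)
  ; upper = Divide y (upper x)
  ; lower-inhabited =
      let (a , l)     = x .lower-inhabited
          (r , h , k) = slope-below 0<b₀ b₀≤c₀ a
      in r , b₀ , c₀ , 0<b₀ , lb₀ , uc₀ , lower-closed≤ x h l , lower-closed≤ x k l
  ; upper-inhabited =
      let (a , u)     = x .upper-inhabited
          (r , h , k) = slope-above 0<b₀ b₀≤c₀ a
      in r , b₀ , c₀ , 0<b₀ , lb₀ , uc₀ , upper-closed≤ x h u , upper-closed≤ x k u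
  ; lower-closed = λ { p<q (b , c , 0<b , lb , uc , h , k) →
      b , c , 0<b , lb , uc
      , x .lower-closed (*-mono′ 0<b p<q) h
      , x .lower-closed (*-mono′ (<-trans 0<b (lower<upper y lb uc)) p<q) k }
  ; upper-closed = λ { p<q (b , c , 0<b , lb , uc , h , k) →
      b , c , 0<b , lb , uc
      , x .upper-closed (*-mono′ 0<b p<q) h
      , x .upper-closed (*-mono′ (<-trans 0<b (lower<upper y lb uc)) p<q) k }
  ; lower-rounded = λ {p} → Divide-lower-rounded {p} x y
  ; upper-rounded = λ {q} → Divide-upper-rounded {q} x y
  ; disjoint = λ {q} → Divide-disjoint {q} x y
  ; located = Divide-located x y 0<b₀ lb₀
  }
  where
  c₀ = proj₁ (y .upper-inhabited)
  uc₀ = proj₂ (y .upper-inhabited)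
  b₀≤c₀ : b₀ ≤ c₀
  b₀≤c₀ = <⇒≤ (lower<upper y lb₀ uc₀)

-- Natural logarithm: log x is the cut of the rationals q with eᵠ < x, x < eᵠ,
-- where, over the integers m ≥ 1 making the base positive,
--   eᵠ = sup (1 + q/m)ᵐ = inf (1 - q/m)⁻ᵐ;
-- m is suc j below.

infix 4 _<exp_ exp_<_

_<exp_ : ℚ → ℚ → Set
r <exp q = ∃[ j ] 0ℚ < 1ℚ + q * (1/1+ j) × r < (1ℚ + q * (1/1+ j)) ^ suc j

exp_<_ : ℚ → ℚ → Set
exp q < r = ∃[ j ] 0ℚ < 1ℚ - q * (1/1+ j) × 1ℚ < r * (1ℚ - q * (1/1+ j)) ^ suc j

abstract
  pos-factor : 0ℚ < b → 1ℚ < r * b → 0ℚ < r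
  pos-factor {b} {r} 0<b h = ≰⇒> λ r≤0 →
    <-irrefl refl (<-trans 0<1 (<-≤-trans h
      (subst (r * b ≤_) (*-zeroˡ b) (*-mono≤′ {r = b} (<⇒≤ 0<b) r≤0))))

  ≤1- : ∀ {t} → 0ℚ < t → p < q → 1ℚ - q * t < 1ℚ - p * t
  ≤1- {p} {q} {t} 0<t p<q = by (0<* (diff p<q) 0<t)
    (solve 3 (λ p q t → con 1ℚ :- p :* t := (con 1ℚ :- q :* t) :+ (q :- p) :* t) refl p q t)

  ≤1+ : ∀ {t} → 0ℚ < t → p < q → 1ℚ + p * t < 1ℚ + q * t
  ≤1+ {p} {q} {t} 0<t p<q = by (0<* (diff p<q) 0<t)
    (solve 3 (λ p q t → con 1ℚ :+ q :* t := (con 1ℚ :+ p :* t) :+ (q :- p) :* t) refl p q t)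

  exp<-closed : p < q → exp q < r → exp p < r
  exp<-closed {p} {q} {r} p<q (j , 0<b , h) =
    let l = ≤1- (0<1/1+ j) p<q
    in j , <-trans 0<b l
         , <-≤-trans h (*-mono≤ {r = r} (<⇒≤ (pos-factor {r = r} (^-0< (suc j) 0<b) h)) (^-mono (suc j) (<⇒≤ 0<b) (<⇒≤ l)))

  <exp-closed : p < q → r <exp p → r <exp q
  <exp-closed {p} {q} {r} p<q (j , 0<b , h) =
    let l = ≤1+ (0<1/1+ j) p<q
    in j , <-trans 0<b l , <-≤-trans h (^-mono (suc j) (<⇒≤ 0<b) (<⇒≤ l))

  exp<-rounded : exp q < r → ∃[ p ] q < p × exp p < r
  exp<-rounded {q} {r} (j , 0<b , h) =
    let 0<r               = pos-factor {r = r} (^-0< (suc j) 0<b) h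
        (w , 0<w , rw)    = inverse 0<r
        (a , 0<a , a<b , w<a^) = ^-open {c = w} (suc j) 0<b (shrink w 0<w rw)
    in ι (suc j) * (1ℚ - a) , close (1/1+ j) (ι (suc j)) a (ι-0< j) (ι*1/1+ j) a<b
     , j , subst (0ℚ <_) (sym (base (1/1+ j) (ι (suc j)) a (ι*1/1+ j))) 0<a
     , subst (λ z → 1ℚ < r * z ^ suc j) (sym (base (1/1+ j) (ι (suc j)) a (ι*1/1+ j)))
         (subst (_< r * a ^ suc j) rw (*-mono {r = r} {p = w} {q = a ^ suc j} 0<r w<a^))
    where
    B : ℚ
    B = (1ℚ - q * (1/1+ j)) ^ suc j
    shrink : ∀ w → 0ℚ < w → r * w ≡ 1ℚ → w < B
    shrink w 0<w rw = subst₂ _<_ (*-identityˡ w)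
      (trans (cong (_* w) (*-comm r B)) (trans (*-assoc B r w) (trans (cong (B *_) rw) (*-identityʳ B))))
      (*-mono′ 0<w h)
    base : ∀ t m a → m * t ≡ 1ℚ → 1ℚ - (m * (1ℚ - a)) * t ≡ a
    base t m a mt = trans (solve 3 (λ t m a → con 1ℚ :- (m :* (con 1ℚ :- a)) :* t := con 1ℚ :- (m :* t) :* (con 1ℚ :- a)) refl t m a)
      (trans (cong (λ z → 1ℚ - z * (1ℚ - a)) mt)
        (solve 1 (λ a → con 1ℚ :- con 1ℚ :* (con 1ℚ :- a) := a) refl a))
    close : ∀ t m a → 0ℚ < m → m * t ≡ 1ℚ → a < 1ℚ - q * t → q < m * (1ℚ - a)
    close t m a 0<m mt a<b = by (0<* 0<m (diff a<b)) (trans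
      (solve 3 (λ x m a → m :* (con 1ℚ :- a) := m :* x :+ m :* ((con 1ℚ :- x) :- a)) refl (q * t) m a)
      (cong (_+ m * ((1ℚ - q * t) - a))
        (trans (solve 3 (λ q t m → m :* (q :* t) := q :* (m :* t)) refl q t m) (trans (cong (q *_) mt) (*-identityʳ q)))))

  <exp-rounded : r <exp q → ∃[ p ] p < q × r <exp p
  <exp-rounded {r} {q} (j , 0<b , h) =
    let (a , 0<a , a<b , r<a^) = ^-open {c = r} (suc j) 0<b h
    in ι (suc j) * (a - 1ℚ) , close (1/1+ j) (ι (suc j)) a (ι-0< j) (ι*1/1+ j) a<b
     , j , subst (0ℚ <_) (sym (base (1/1+ j) (ι (suc j)) a (ι*1/1+ j))) 0<a
     , subst (λ z → r < z ^ suc j) (sym (base (1/1+ j) (ι (suc j)) a (ι*1/1+ j))) r<a^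
    where
    base : ∀ t m a → m * t ≡ 1ℚ → 1ℚ + (m * (a - 1ℚ)) * t ≡ a
    base t m a mt = trans (solve 3 (λ t m a → con 1ℚ :+ (m :* (a :- con 1ℚ)) :* t := con 1ℚ :+ (m :* t) :* (a :- con 1ℚ)) refl t m a)
      (trans (cong (λ z → 1ℚ + z * (a - 1ℚ)) mt)
        (solve 1 (λ a → con 1ℚ :+ con 1ℚ :* (a :- con 1ℚ) := a) refl a))
    close : ∀ t m a → 0ℚ < m → m * t ≡ 1ℚ → a < 1ℚ + q * t → m * (a - 1ℚ) < q
    close t m a 0<m mt a<b = by (0<* 0<m (diff a<b)) (trans
      (sym (trans (solve 3 (λ q t m → m :* (q :* t) := q :* (m :* t)) refl q t m) (trans (cong (q *_) mt) (*-identityʳ q))))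
      (solve 3 (λ x m a → m :* x := m :* (a :- con 1ℚ) :+ m :* ((con 1ℚ :+ x) :- a)) refl (q * t) m a))

  -- Bernoulli brings both bounds to the common exponent (suc i)(suc j).
  ^-refine : ∀ n t → 0ℚ < 1ℚ + ι (suc n) * t → 0ℚ ≤ 1ℚ + t
  ^-refine n t h with ≤-total 0ℚ t
  ... | inj₁ 0≤t = 0≤+ (<⇒≤ 0<1) 0≤t
  ... | inj₂ t≤0 = ≤-trans (<⇒≤ h) (subst (λ z → 1ℚ + z * t ≤ 1ℚ + t) (sym (ι-suc n))
        (by≤ (0≤* (ι-0≤ n) (diff≤ t≤0))
          (solve 2 (λ n t → con 1ℚ :+ t := (con 1ℚ :+ (con 1ℚ :+ n) :* t) :+ n :* (con 0ℚ :- t)) refl (ι n) t)))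

  exp-product≤1 : ∀ i j t → 0ℚ < 1ℚ + ι (suc j) * t → 0ℚ < 1ℚ + ι (suc i) * (- t) →
                  (1ℚ + ι (suc j) * t) ^ suc i * (1ℚ + ι (suc i) * (- t)) ^ suc j ≤ 1ℚ
  exp-product≤1 i j t h k = ≤-trans
    (≤-trans
      (*-mono≤ {r = (1ℚ + ι (suc j) * t) ^ suc i} (^-0≤ (suc i) (<⇒≤ h)) (^-mono (suc j) (<⇒≤ k) (bernoulli (suc i) (- t) k′)))
      (*-mono≤′ {r = ((1ℚ - t) ^ suc i) ^ suc j} (^-0≤ (suc j) (^-0≤ (suc i) k′)) (^-mono (suc i) (<⇒≤ h) (bernoulli (suc j) t h′))))
    (subst (_≤ 1ℚ) (sym eq) (^-≤1 (suc j ℕ.* suc i) (0≤* h′ k′)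
      (by≤ (square t) (solve 1 (λ t → con 1ℚ := (con 1ℚ :+ t) :* (con 1ℚ :- t) :+ t :* t) refl t))))
    where
    h′ : 0ℚ ≤ 1ℚ + t
    h′ = ^-refine j t h
    k′ : 0ℚ ≤ 1ℚ - t
    k′ = ^-refine i (- t) k
    eq : ((1ℚ + t) ^ suc j) ^ suc i * ((1ℚ - t) ^ suc i) ^ suc j ≡ ((1ℚ + t) * (1ℚ - t)) ^ (suc j ℕ.* suc i)
    eq = trans (cong₂ _*_ (^-assocʳ (1ℚ + t) (suc j) (suc i))
                 (trans (^-assocʳ (1ℚ - t) (suc i) (suc j)) (cong ((1ℚ - t) ^_) (ℕₚ.*-comm (suc i) (suc j)))))
               (sym (^-distrib-* (1ℚ + t) (1ℚ - t) (suc j ℕ.* suc i)))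

  exp-separated : ∀ {u v} → v <exp q → exp q < u → v < u
  exp-separated {q} {u} {v} (i , h , v<) (j , k , <u) = ≰⇒> λ u≤v →
    <-irrefl refl (<-≤-trans
      (<-trans (<-≤-trans <u (*-mono≤′ {r = B} (<⇒≤ 0<B) u≤v)) (*-mono′ {r = B} 0<B v<))
      (subst₂ (λ a b → a ^ suc i * b ^ suc j ≤ 1ℚ) (sym eqA) (sym eqB)
        (exp-product≤1 i j t (subst (0ℚ <_) eqA h) (subst (0ℚ <_) eqB k))))
    where
    B t : ℚ
    B = (1ℚ - q * (1/1+ j)) ^ suc j
    t = (q * (1/1+ i)) * (1/1+ j)
    0<B : 0ℚ < B
    0<B = ^-0< (suc j) k
    identA : ∀ x y m → m * y ≡ 1ℚ → 1ℚ + x ≡ 1ℚ + m * (x * y)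
    identA x y m my = cong (λ z → 1ℚ + z) (sym (trans (solve 3 (λ x y m → m :* (x :* y) := x :* (m :* y)) refl x y m)
      (trans (cong (x *_) my) (*-identityʳ x))))
    identB : ∀ q x y n → n * x ≡ 1ℚ → 1ℚ - q * y ≡ 1ℚ + n * (- ((q * x) * y))
    identB q x y n nx = cong (λ z → 1ℚ + z) {x = - (q * y)} (sym (trans (solve 4 (λ q x y n → n :* (:- ((q :* x) :* y)) := :- (q :* y) :* (n :* x)) refl q x y n)
      (trans (cong (- (q * y) *_) nx) (*-identityʳ _))))
    eqA : 1ℚ + q * (1/1+ i) ≡ 1ℚ + ι (suc j) * t
    eqA = identA (q * (1/1+ i)) (1/1+ j) (ι (suc j)) (ι*1/1+ j)
    eqB : 1ℚ - q * (1/1+ j) ≡ 1ℚ + ι (suc i) * (- t)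
    eqB = identB q (1/1+ i) (1/1+ j) (ι (suc i)) (ι*1/1+ i)

  scale< : ∀ {t m} → 0ℚ < t → m * t ≡ 1ℚ → p < m → p * t < 1ℚ
  scale< {p} {t} 0<t mt h = subst (p * t <_) mt (*-mono′ 0<t h)

  exp-located-at : ∀ j → p < q → p < ι (suc j) → - q < ι (suc j) →
                   ∀ w → 0ℚ < w → (q - p) * w ≡ 1ℚ → (p * q) * w < ι (suc j) →
                   ∃₂ λ u v → u < v × exp p < u × v <exp q
  exp-located-at {p} {q} j p<q p<m -q<m w 0<w dw pqw<m =
    let 0<A = by (diff (scale< 0<t mt -q<m)) (solve 2 (λ q t → con 1ℚ :+ q :* t := con 0ℚ :+ (con 1ℚ :- (:- q) :* t)) refl q t)
        0<B = diff (scale< 0<t mt p<m)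
        (z , 0<z , Bz) = inverse (^-0< (suc j) 0<B)
        z<A = subst₂ _<_ (*-identityˡ z)
                (trans (*-assoc (A ^ suc j) (B ^ suc j) z) (trans (cong (A ^ suc j *_) Bz) (*-identityʳ _)))
                (*-mono′ 0<z 1<AB^)
        (u , z<u , u<A) = <-dense z<A
        (v , u<v , v<A) = <-dense u<A
    in u , v , u<v , (j , 0<B , subst (_< u * B ^ suc j) (trans (*-comm z (B ^ suc j)) Bz) (*-mono′ (^-0< (suc j) 0<B) z<u))
     , (j , 0<A , v<A)
    where
    t m A B : ℚ
    t = 1/1+ j
    m = ι (suc j)
    A = 1ℚ + q * t
    B = 1ℚ - p * t
    0<t : 0ℚ < t
    0<t = 0<1/1+ j
    mt : m * t ≡ 1ℚ
    mt = ι*1/1+ j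
    pq<m[q-p] : p * q < m * (q - p)
    pq<m[q-p] = subst (_< m * (q - p)) (a*b*b⁻¹ (p * q) dw) (*-mono′ (diff p<q) pqw<m)
    pqt<q-p : (p * q) * t < q - p
    pqt<q-p = subst ((p * q) * t <_)
      (trans (solve 3 (λ m x t → (m :* x) :* t := x :* (m :* t)) refl m (q - p) t)
        (trans (cong ((q - p) *_) mt) (*-identityʳ _)))
      (*-mono′ 0<t pq<m[q-p])
    1<AB : 1ℚ < A * B
    1<AB = by (0<* 0<t (diff pqt<q-p))
      (solve 3 (λ p q t → (con 1ℚ :+ q :* t) :* (con 1ℚ :- p :* t) := con 1ℚ :+ t :* ((q :- p) :- (p :* q) :* t)) refl p q t)
    1<AB^ : 1ℚ < A ^ suc j * B ^ suc j
    1<AB^ = subst (1ℚ <_) (^-distrib-* A B (suc j)) (1<^ j 1<AB)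

  exp-located : p < q → ∃₂ λ u v → u < v × exp p < u × v <exp q
  exp-located {p} {q} p<q =
    let (w , 0<w , dw) = inverse (diff p<q)
        (j , <m)       = archimedean (p ⊔ (- q ⊔ (p * q) * w))
        -q⊔            = ≤-<-trans (p≤q⊔p p (- q ⊔ (p * q) * w)) <m
    in exp-located-at j p<q (≤-<-trans (p≤p⊔q p (- q ⊔ (p * q) * w)) <m)
         (≤-<-trans (p≤p⊔q (- q) ((p * q) * w)) -q⊔)
         w 0<w dw (≤-<-trans (p≤q⊔p (- q) ((p * q) * w)) -q⊔)

  exp<-inhabited : 0ℚ < r → ∃[ q ] exp q < r
  exp<-inhabited {r} 0<r =
    let (w , 0<w , rw) = inverse 0<r
    in 1ℚ - (w + w) , 0 , subst (0ℚ <_) (sym (base w)) (0<+ 0<w 0<w)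
     , subst (1ℚ <_) (sym (two w rw)) (from-yes (1ℚ <? 1ℚ + 1ℚ))
    where
    base : ∀ w → 1ℚ - (1ℚ - (w + w)) * 1ℚ ≡ w + w
    base w = solve 1 (λ w → con 1ℚ :- (con 1ℚ :- (w :+ w)) :* con 1ℚ := w :+ w) refl w
    two : ∀ w → r * w ≡ 1ℚ → r * (1ℚ - (1ℚ - (w + w)) * 1ℚ) ^ 1 ≡ 1ℚ + 1ℚ
    two w rw = trans (cong (λ z → r * (z * 1ℚ)) (base w))
      (trans (solve 2 (λ r w → r :* ((w :+ w) :* con 1ℚ) := r :* w :+ r :* w) refl r w) (cong₂ _+_ rw rw))

  <exp-inhabited : 0ℚ < r → ∃[ q ] r <exp q
  <exp-inhabited {r} 0<r = r , 0
    , subst (0ℚ <_) (sym base) (0<+ 0<1 0<r)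
    , subst (r <_) (sym (trans (*-identityʳ _) base)) (by 0<1 (+-comm 1ℚ r))
    where
    base : 1ℚ + r * 1ℚ ≡ 1ℚ + r
    base = cong (λ z → 1ℚ + z) (*-identityʳ r)

log_⟨_⟩ : (x : ℝ) → fromℕ 0 <ᴿ x → ℝ
log x ⟨ a , 0<a , la ⟩ = record
  { lower = λ q → ∃[ u ] lower x u × exp q < u
  ; upper = λ q → ∃[ v ] upper x v × v <exp q
  ; lower-inhabited = let (q , h) = exp<-inhabited 0<a in q , a , la , h
  ; upper-inhabited =
      let (v , uv) = x .upper-inhabited
          (q , h)  = <exp-inhabited (<-trans 0<a (lower<upper x la uv))
      in q , v , uv , h
  ; lower-closed = λ { {p} {q} p<q (u , lu , h) → u , lu , exp<-closed {p} {q} {u} p<q h }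
  ; upper-closed = λ { {p} {q} p<q (v , uv , h) → v , uv , <exp-closed {p} {q} {v} p<q h }
  ; lower-rounded = λ { {p} (u , lu , h) → let (q , p<q , k) = exp<-rounded {p} {u} h in q , p<q , u , lu , k }
  ; upper-rounded = λ { {q} (v , uv , h) → let (p , p<q , k) = <exp-rounded {v} {q} h in p , p<q , v , uv , k }
  ; disjoint = λ { {q} (u , lu , h) (v , uv , k) → <-asym (lower<upper x lu uv) (exp-separated {q} {u} {v} k h) }
  ; located = λ p<q → let (u , v , u<v , h , k) = exp-located p<q in
      [ (λ lu → inj₁ (u , lu , h)) , (λ uv → inj₂ (v , uv , k)) ]′ (x .located u<v)
  }

-- From 3 on, log n > 1, so that log log n > 0.

abstract
  2<n : ∀ {n} → 3 ℕ.≤ n → + 297 / 100 < ι n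
  2<n 3≤n = <-≤-trans (from-yes (+ 297 / 100 <? ι 3)) (ι-mono 3≤n)

  exp[19/18]<2·97 : exp (+ 19 / 18) < (+ 297 / 100)
  exp[19/18]<2·97 = 18
    , from-yes (0ℚ <? 1ℚ - (+ 19 / 18) * (1/1+ 18))
    , from-yes (1ℚ <? (+ 297 / 100) * (1ℚ - (+ 19 / 18) * (1/1+ 18)) ^ 19)

  exp[1/50]<19/18 : exp (+ 1 / 50) < (+ 19 / 18)
  exp[1/50]<19/18 = 0
    , from-yes (0ℚ <? 1ℚ - (+ 1 / 50) * (1/1+ 0))
    , from-yes (1ℚ <? (+ 19 / 18) * (1ℚ - (+ 1 / 50) * (1/1+ 0)) ^ 1)

0<fromℕ : ∀ n → 3 ℕ.≤ n → fromℕ 0 <ᴿ fromℕ n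
0<fromℕ n 3≤n = 1ℚ , 0<1 , <-trans (from-yes (1ℚ <? + 297 / 100)) (2<n 3≤n)

ln : ∀ n → 3 ℕ.≤ n → ℝ
ln n 3≤n = log fromℕ n ⟨ 0<fromℕ n 3≤n ⟩

0<ln : ∀ n (3≤n : 3 ℕ.≤ n) → fromℕ 0 <ᴿ ln n 3≤n
0<ln n 3≤n = + 19 / 18 , from-yes (0ℚ <? + 19 / 18) , + 297 / 100 , 2<n 3≤n , exp[19/18]<2·97

lnln : ∀ n → 3 ℕ.≤ n → ℝ
lnln n 3≤n = log ln n 3≤n ⟨ 0<ln n 3≤n ⟩

0<lnln : ∀ n (3≤n : 3 ℕ.≤ n) → fromℕ 0 <ᴿ lnln n 3≤n
0<lnln n 3≤n = + 1 / 50 , from-yes (0ℚ <? + 1 / 50)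
  , + 19 / 18 , proj₂ (proj₂ (0<ln n 3≤n)) , exp[1/50]<19/18

record Graph (n : ℕ) : Set₁ where
  infix 4 _~_
  field
    _~_   : Rel (Fin n) 0ℓ
    ~-sym : Symmetric _~_
    ~-irr : Irreflexive _≡_ _~_
    _~?_  : Decidable _~_

open Graph using (_~_)

TriangleFree : ∀ {n} → Graph n → Set
TriangleFree G = ∀ u v w → ¬ (u ~ᴳ v × v ~ᴳ w × w ~ᴳ u)
  where open Graph G renaming (_~_ to _~ᴳ_)

record Embedding {m n} (H : Graph m) (G : Graph n) : Set where
  field
    to        : Fin m → Fin n
    injective : ∀ {u v} → to u ≡ to v → u ≡ v
    adjacency : ∀ u v → H ._~_ u v ⇔ G ._~_ (to u) (to v)

-- The domain is { u ∣ to u ≢ nothing }; the codomain is the image.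

record PartialEmbedding {m n} (H : Graph m) (G : Graph n) : Set where
  field
    to        : Fin m → Maybe (Fin n)
    injective : ∀ {u v x} → to u ≡ just x → to v ≡ just x → u ≡ v
    adjacency : ∀ {u v x y} → to u ≡ just x → to v ≡ just y →
                H ._~_ u v ⇔ G ._~_ x y

_Extends_ : ∀ {m n} {H : Graph m} {G : Graph n} →
            Embedding H G → PartialEmbedding H G → Set
φ Extends θ = ∀ {u x} → PartialEmbedding.to θ u ≡ just x → Embedding.to φ u ≡ x

IsECTF : ℕ → ∀ {n} → Graph n → Set₁
IsECTF k G =
  TriangleFree G ×
  (∀ (H : Graph (suc k)) → TriangleFree H → (θ : PartialEmbedding H G) →
   Σ (Embedding H G) (_Extends θ))

HasECTF : ℕ → ℕ → Set₁
HasECTF k n = Σ (Graph n) (IsECTF k)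

-- k is f(n), the largest positive integer for which a k-ECTF graph on n
-- vertices exists.

IsLargestECTF : ℕ → ℕ → Set₁
IsLargestECTF k n =
  1 ℕ.≤ k × HasECTF k n × (∀ k′ → 1 ℕ.≤ k′ → HasECTF k′ n → k′ ℕ.≤ k)

{-# OPTIONS --safe #-}
module Submission where

-- Neighbourhoods in G are independent, so if G contains a copy of a triangle-free
-- graph R on r vertices with independence number at most α, then for each S ⊆ V(G)
-- every vertex of S has at most α neighbours in the copy, and some vertex of the
-- copy has at most (α / r) |S| neighbours in S.
-- In a k-ECTF graph such a copy exists away from any few independent vertices
-- chosen before; starting from S = V(G) one thus picks independent x₁, …, xₛ,
-- s = k - r, with at most (α / r)ˢ n common neighbours. But they have one, so
-- (r / α)ˢ ≤ n.
-- Iterating a construction of Chung, Cleve and Dagum gives R with r = 6ʲ and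
-- α = 4ʲ. For 16 · 6ʲ ≤ k and 3 j ≥ log log n, the bound (3/2)^(j s) ≤ n
-- contradicts k > 8 log n / log log n, because log (3/2) > 2/5.

open import Defs using (ι; _<ᴿ_; _≤ᴿ_; fromℕ; _·_; _÷ᴿ_⟨_⟩; ln; lnln; 0<lnln; HasECTF; IsLargestECTF)
open import Data.Nat using (ℕ; _≤_)
open import Data.Product using (Σ; _×_; ∃-syntax)
open import Data.Rational using (ℚ; Positive)
open import Relation.Nullary using (¬_)

open import Data.Bool using (Bool; true; false; T; _∧_; _∨_; if_then_else_)
open import Data.Bool.Properties using (T-∧; T-∨; T?)
open import Data.Empty using (⊥; ⊥-elim)
open import Data.Fin as Fin using (Fin; zero; suc; toℕ; splitAt; _↑ˡ_; _↑ʳ_; combine; remQuot)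
open import Data.Fin.Patterns using (0F; 1F; 2F; 3F; 4F; 5F)
open import Data.Fin.Properties using (splitAt-↑ˡ; splitAt-↑ʳ; splitAt⁻¹-↑ˡ; remQuot-combine; all?; any?)
import Data.Integer as ℤ
open import Data.Maybe using (Maybe; just; nothing)
open import Data.Maybe.Properties using (just-injective)
open import Data.Nat using (zero; suc; _+_; _*_; _∸_; _^_; _<_; z≤n; s≤s; _≤?_; ∣_-_∣; NonZero; >-nonZero; ≢-nonZero⁻¹)
open import Data.Nat.Properties
open import Data.Nat.Tactic.RingSolver using (solve-∀)
open import Data.Product using (_,_; proj₁; proj₂)
open import Data.Rational as ℚ using (0ℚ; 1ℚ; ½; _/_)
import Data.Rational.Properties as ℚₚ
open import Data.Rational.Solver using (module +-*-Solver)
open import Data.Sum using (_⊎_; inj₁; inj₂; [_,_]′)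
open import Data.Unit using (tt)
open import Defs
  using ( Graph; TriangleFree; Embedding; PartialEmbedding; _Extends_; IsECTF
        ; 1/1+_; _<exp_; exp_<_; exp<-closed; <exp-closed; exp-separated; archimedean
        ; by; diff; diff≤; *-mono; *-mono′; *-mono≤; *-mono≤′; 0<*; 0≤*; 0≤+
        ; ι-suc; ι-0≤; ι-0<; ι-mono; ι*1/1+
        ; ^-0<; ^-mono; 1<^; ^-distrib-*; ^-assocʳ )
  renaming (_^_ to _^ℚ_)
open import Function using (_∘_; _on_)
open import Function.Bundles using (_⇔_; mk⇔; Equivalence)
open import Level using (0ℓ)
open import Relation.Binary using (Rel; Symmetric; Decidable)
open import Relation.Binary.PropositionalEquality hiding (J)
open import Relation.Nullary using (yes; no)
open import Relation.Nullary.Decidable using (from-yes; toWitness; fromWitness; isYes; ¬?; _×-dec_; _⊎-dec_)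

open import Algebra.Properties.Semiring.Sum +-*-semiring
  using (sum; sum-cong-≗; sum-replicate-zero; ∑-distrib-+; ∑-comm; *-distribˡ-sum)
open +-*-Solver using (solve; con; _:=_; _:+_; _:*_; _:-_)

private variable
  i k m n r α : ℕ

-- Cardinalities of Boolean subsets of `Fin n`

χ : Bool → ℕ
χ b = if b then 1 else 0

count : (Fin n → Bool) → ℕ
count P = sum (χ ∘ P)

sum-mono : {f g : Fin n → ℕ} → (∀ v → f v ≤ g v) → sum f ≤ sum g
sum-mono {zero}  h = z≤n
sum-mono {suc n} h = +-mono-≤ (h zero) (sum-mono (h ∘ suc))

sum-const-1 : ∀ n → sum {n} (λ _ → 1) ≡ n
sum-const-1 zero    = refl
sum-const-1 (suc n) = cong suc (sum-const-1 n)

sum-++ : ∀ m (f : Fin (m + n) → ℕ) → sum f ≡ sum (f ∘ (_↑ˡ n)) + sum (f ∘ (m ↑ʳ_))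
sum-++ zero    f = refl
sum-++ (suc m) f = trans (cong (f zero +_) (sum-++ m (f ∘ suc))) (sym (+-assoc (f zero) _ _))

sum-combine : ∀ m n (f : Fin (m * n) → ℕ) → sum f ≡ sum (λ i → sum (λ v → f (combine {m} i v)))
sum-combine zero    n f = refl
sum-combine (suc m) n f = trans (sum-++ n f) (cong (sum (f ∘ (_↑ˡ m * n)) +_) (sum-combine m n (f ∘ (n ↑ʳ_))))

minimum≤average : .{{NonZero r}} → (f : Fin r → ℕ) → ∃[ a ] r * f a ≤ sum f
minimum≤average {suc zero}    f = zero , ≤-refl
minimum≤average {suc (suc r)} f =
  let (a , h) = minimum≤average (f ∘ suc) in
  [ (λ f0≤fa → zero , +-monoʳ-≤ (f zero) (≤-trans (*-monoʳ-≤ (suc r) f0≤fa) h))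
  , (λ fa≤f0 → suc a , +-mono-≤ fa≤f0 h)
  ]′ (≤-total (f zero) (f (suc a)))

Independent : Graph n → (Fin n → Bool) → Set
Independent G P = ∀ {u v} → T (P u) → T (P v) → ¬ Graph._~_ G u v

_IndependenceBoundOf_ : ℕ → Graph n → Set
α IndependenceBoundOf G = ∀ P → Independent G P → count P ≤ α

count-∨-∧ : (P Q : Fin n → Bool) →
            count P + count Q ≡ count (λ v → P v ∨ Q v) + count (λ v → P v ∧ Q v)
count-∨-∧ P Q = begin
  count P + count Q                          ≡⟨ ∑-distrib-+ (χ ∘ P) (χ ∘ Q) ⟨
  sum (λ v → χ (P v) + χ (Q v))              ≡⟨ sum-cong-≗ (λ v → lemma (P v) (Q v)) ⟩
  sum (λ v → χ (P v ∨ Q v) + χ (P v ∧ Q v))  ≡⟨ ∑-distrib-+ (λ v → χ (P v ∨ Q v)) (λ v → χ (P v ∧ Q v)) ⟩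
  count (λ v → P v ∨ Q v) + count (λ v → P v ∧ Q v) ∎
  where
  open ≡-Reasoning
  lemma : ∀ a b → χ a + χ b ≡ χ (a ∨ b) + χ (a ∧ b)
  lemma true  true  = refl
  lemma true  false = refl
  lemma false true  = refl
  lemma false false = refl

count-disjoint-∨ : (P Q : Fin n → Bool) → (∀ v → T (P v) → T (Q v) → ⊥) →
                   count P + count Q ≤ count (λ v → P v ∨ Q v)
count-disjoint-∨ P Q disjoint = begin
  count P + count Q              ≡⟨ ∑-distrib-+ (χ ∘ P) (χ ∘ Q) ⟨
  sum (λ v → χ (P v) + χ (Q v))  ≤⟨ sum-mono (λ v → lemma (P v) (Q v) (disjoint v)) ⟩
  count (λ v → P v ∨ Q v)        ∎
  where
  open ≤-Reasoning
  lemma : ∀ a b → (T a → T b → ⊥) → χ a + χ b ≤ χ (a ∨ b)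
  lemma true  true  h = ⊥-elim (h tt tt)
  lemma true  false h = ≤-refl
  lemma false b     h = ≤-refl

-- Triangle-free graphs on 6ʲ vertices with independence number at most 4ʲ

module _ {X : Set} (_~_ : Rel X 0ℓ) (~-sym : Symmetric _~_) (~-irr : ∀ x → ¬ (x ~ x))
         (_~?_ : Decidable _~_) where

  -- `f` may identify vertices: those with equal images are non-adjacent by irreflexivity on `X`.
  -- This lets adjacency be defined on structured labels, with `f` decoding the vertex numbers.
  pullback : (Fin n → X) → Graph n
  pullback f = record
    { _~_   = _~_ on f
    ; ~-sym = λ {u} {v} → ~-sym {f u} {f v}
    ; ~-irr = λ { {u} refl → ~-irr (f u) }
    ; _~?_  = λ u v → f u ~? f v
    }

-- The fibration of Chung, Cleve and Dagum: each vertex of G becomes three opposite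
-- pairs of a hexagon, and each edge of G joins the equal or consecutive corners.

Opposite Close : Rel (Fin 6) 0ℓ
Opposite i j = ∣ toℕ i - toℕ j ∣ ≡ 3
Close    i j = ∣ toℕ i - toℕ j ∣ ≤ 1 ⊎ ∣ toℕ i - toℕ j ∣ ≡ 5

opposite? : Decidable Opposite
opposite? i j = ∣ toℕ i - toℕ j ∣ ≟ 3

close? : Decidable Close
close? i j = ∣ toℕ i - toℕ j ∣ ≤? 1 ⊎-dec ∣ toℕ i - toℕ j ∣ ≟ 5

opposite-sym : Symmetric Opposite
opposite-sym {i} {j} = trans (∣-∣-comm (toℕ j) (toℕ i))

close-sym : Symmetric Close
close-sym {i} {j} = subst (λ d → d ≤ 1 ⊎ d ≡ 5) (∣-∣-comm (toℕ i) (toℕ j))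

opposite-irr : ∀ i → ¬ Opposite i i
opposite-irr = from-yes (all? λ i → ¬? (opposite? i i))

-- The antipode of the antipode is the corner itself, so `l` would equal `i`.
no-opposite-triangle : ∀ i j l → ¬ (Opposite i j × Opposite j l × Opposite l i)
no-opposite-triangle = from-yes (all? λ i → all? λ j → all? λ l →
  ¬? (opposite? i j ×-dec opposite? j l ×-dec opposite? l i))

-- Two corners close to a common third are at most two steps apart on the hexagon, while opposite
-- corners are three apart.
close-to-opposite : ∀ i j l → ¬ (Opposite i j × Close j l × Close l i)
close-to-opposite = from-yes (all? λ i → all? λ j → all? λ l →
  ¬? (opposite? i j ×-dec close? j l ×-dec close? l i))

module Fibration (G : Graph n) where
  open Graph G

  infix 4 _≈_
  _≈_ : Rel (Fin 6 × Fin n) 0ℓ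
  (i , u) ≈ (j , v) = (u ≡ v × Opposite i j) ⊎ (u ~ v × Close i j)

  ≈-sym : Symmetric _≈_
  ≈-sym {i , _} {j , _} (inj₁ (eq , o)) = inj₁ (sym eq , opposite-sym {i} {j} o)
  ≈-sym {i , _} {j , _} (inj₂ (e    , c)) = inj₂ (~-sym e , close-sym {i} {j} c)

  ≈-irr : ∀ x → ¬ (x ≈ x)
  ≈-irr (i , _) (inj₁ (_ , o)) = opposite-irr i o
  ≈-irr _       (inj₂ (e , _)) = ~-irr refl e

  ≈? : Decidable _≈_
  ≈? (i , u) (j , v) = (u Fin.≟ v ×-dec opposite? i j) ⊎-dec (u ~? v ×-dec close? i j)

  fibration : Graph (6 * n)
  fibration = pullback _≈_ (λ {x} {y} → ≈-sym {x} {y}) ≈-irr ≈? (remQuot n)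

  -- Sort triangles by their number of edges inside a fibre: three give mutually opposite corners,
  -- two force a loop in `G`, one gives opposite corners close to a common corner, and none projects
  -- to a triangle of `G`.
  ≈-triangleFree : TriangleFree G → ∀ x y z → ¬ (x ≈ y × y ≈ z × z ≈ x)
  ≈-triangleFree free (i , _) (j , _) (l , _) = λ
    { (inj₁ (_ , o) , inj₁ (_ , o′) , inj₁ (_ , o″)) → no-opposite-triangle i j l (o , o′ , o″)
    ; (inj₁ (refl , _) , inj₁ (refl , _) , inj₂ (e , _)) → ~-irr refl e
    ; (inj₁ (refl , _) , inj₂ (e , _) , inj₁ (refl , _)) → ~-irr refl e
    ; (inj₂ (e , _) , inj₁ (refl , _) , inj₁ (refl , _)) → ~-irr refl e
    ; (inj₁ (_ , o) , inj₂ (_ , c) , inj₂ (_ , c′)) → close-to-opposite i j l (o , c , c′)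
    ; (inj₂ (_ , c) , inj₁ (_ , o) , inj₂ (_ , c′)) → close-to-opposite j l i (o , c′ , c)
    ; (inj₂ (_ , c) , inj₂ (_ , c′) , inj₁ (_ , o)) → close-to-opposite l i j (o , c , c′)
    ; (inj₂ (e , _) , inj₂ (e′ , _) , inj₂ (e″ , _)) → free _ _ _ (e , e′ , e″)
    }

  fibration-triangleFree : TriangleFree G → TriangleFree fibration
  fibration-triangleFree free u v w =
    ≈-triangleFree free (remQuot n u) (remQuot n v) (remQuot n w)

  module _ (P : Fin (6 * n) → Bool) (independent : Independent fibration P) where

    layer : Fin 6 → Fin n → Bool
    layer i v = P (combine i v)

    apart : ∀ i j {u v} → T (layer i u) → T (layer j v) → ¬ ((i , u) ≈ (j , v))
    apart i j {u} {v} pu pv e = independent pu pv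
      (subst₂ _≈_ (sym (remQuot-combine i u)) (sym (remQuot-combine j v)) e)

    -- Pair the layers 2p and 2p + 1: |A| + |B| = |A ∪ B| + |A ∩ B|. The three unions
    -- are independent, and so is the (disjoint) union of the three intersections.
    some every : Fin 3 → Fin n → Bool
    some  p v = layer (combine {3} {2} p zero) v ∨ layer (combine {3} {2} p (suc zero)) v
    every p v = layer (combine {3} {2} p zero) v ∧ layer (combine {3} {2} p (suc zero)) v

    -- Corners 2p and 2p + 1 are equal or consecutive in any combination, so an edge of `G` between
    -- two members would lift to an edge inside `P`.
    some-independent : ∀ p → Independent G (some p)
    some-independent p {u} {v} pu pv u~v =
      [ (λ h → [ go 0F 0F h , go 0F 1F h ]′ (Equivalence.to T-∨ pv))
      , (λ h → [ go 1F 0F h , go 1F 1F h ]′ (Equivalence.to T-∨ pv))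
      ]′ (Equivalence.to T-∨ pu)
      where
      close : ∀ p a b → Close (combine {3} {2} p a) (combine {3} {2} p b)
      close = from-yes (all? {3} λ p → all? {2} λ a → all? {2} λ b → close? (combine p a) (combine p b))
      go : ∀ a b → T (layer (combine {3} {2} p a) u) → T (layer (combine {3} {2} p b) v) → ⊥
      go a b h k = apart (combine {3} {2} p a) (combine {3} {2} p b) h k (inj₂ (u~v , close p a b))

    every⇒layer : ∀ p a {v} → T (every p v) → T (layer (combine {3} {2} p a) v)
    every⇒layer p 0F h = proj₁ (Equivalence.to T-∧ h)
    every⇒layer p 1F h = proj₂ (Equivalence.to T-∧ h)

    -- A member lies in both layers of its pair, so the corners may be chosen freely; any two of the
    -- pairs {0,1}, {2,3}, {4,5} contain close corners.
    every-independent : ∀ p q {u v} → T (every p u) → T (every q v) → ¬ (u ~ v)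
    every-independent p q hu hv u~v =
      let (a , b , c) = close p q in
      apart (combine {3} {2} p a) (combine {3} {2} q b) (every⇒layer p a hu) (every⇒layer q b hv) (inj₂ (u~v , c))
      where
      close : ∀ p q → ∃[ a ] ∃[ b ] Close (combine {3} {2} p a) (combine {3} {2} q b)
      close = from-yes (all? {3} λ p → all? {3} λ q → any? {2} λ a → any? {2} λ b → close? (combine p a) (combine q b))

    -- Different pairs contain opposite corners (0 and 3, 2 and 5, 1 and 4), and over a common
    -- vertex these are adjacent in the fibration.
    every-disjoint : ∀ p q → p ≢ q → ∀ v → T (every p v) → T (every q v) → ⊥
    every-disjoint p q p≢q v hp hq = [ p≢q , (λ (a , b , o) →
      apart (combine {3} {2} p a) (combine {3} {2} q b) (every⇒layer p a hp) (every⇒layer q b hq) (inj₁ (refl , o))) ]′ (opposite p q)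
      where
      opposite : ∀ p q → p ≡ q ⊎ ∃[ a ] ∃[ b ] Opposite (combine {3} {2} p a) (combine {3} {2} q b)
      opposite = from-yes (all? {3} λ p → all? {3} λ q → p Fin.≟ q ⊎-dec
        any? {2} λ a → any? {2} λ b → opposite? (combine p a) (combine q b))

    anyPair : Fin n → Bool
    anyPair v = every 0F v ∨ (every 1F v ∨ every 2F v)

    anyPair⇒every : ∀ {v} → T (anyPair v) → ∃[ p ] T (every p v)
    anyPair⇒every h with Equivalence.to T-∨ h
    ... | inj₁ h₀ = 0F , h₀
    ... | inj₂ h′ with Equivalence.to T-∨ h′
    ...   | inj₁ h₁ = 1F , h₁
    ...   | inj₂ h₂ = 2F , h₂

    anyPair-independent : Independent G anyPair
    anyPair-independent hu hv =
      let (p , hp) = anyPair⇒every hu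
          (q , hq) = anyPair⇒every hv
      in every-independent p q hp hq

    -- The trailing `+ 0` makes the right-hand side match the unfolding of `4 * α`.
    count-layers : count P ≤ count (some 0F) + (count (some 1F) + (count (some 2F) + (count anyPair + 0)))
    count-layers = begin
      count P                                   ≡⟨ sum-combine 6 n (χ ∘ P) ⟩
      sum {6} (λ i → count (layer i))           ≡⟨ regroup (count (layer 0F)) (count (layer 1F)) (count (layer 2F)) (count (layer 3F)) (count (layer 4F)) (count (layer 5F)) ⟩
      pair 0F + (pair 1F + pair 2F)             ≡⟨ cong₂ _+_ (split 0F) (cong₂ _+_ (split 1F) (split 2F)) ⟩
      (S 0F + E 0F) + ((S 1F + E 1F) + (S 2F + E 2F)) ≡⟨ regroup′ (S 0F) (E 0F) (S 1F) (E 1F) (S 2F) (E 2F) ⟩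
      S 0F + (S 1F + (S 2F + (E 0F + (E 1F + E 2F) + 0))) ≤⟨ +-monoʳ-≤ (S 0F) (+-monoʳ-≤ (S 1F) (+-monoʳ-≤ (S 2F) (+-monoˡ-≤ 0 disjoint))) ⟩
      S 0F + (S 1F + (S 2F + (count anyPair + 0))) ∎
      where
      open ≤-Reasoning
      pair S E : Fin 3 → ℕ
      pair p = count (layer (combine {3} {2} p zero)) + count (layer (combine {3} {2} p (suc zero)))
      S p = count (some p)
      E p = count (every p)
      split : ∀ p → pair p ≡ S p + E p
      split p = count-∨-∧ (layer (combine {3} {2} p zero)) (layer (combine {3} {2} p (suc zero)))
      disjoint : E 0F + (E 1F + E 2F) ≤ count anyPair
      disjoint = ≤-trans (+-monoʳ-≤ (E 0F) (count-disjoint-∨ (every 1F) (every 2F) (every-disjoint 1F 2F λ ())))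
        (count-disjoint-∨ (every 0F) (λ v → every 1F v ∨ every 2F v) λ v h k →
          [ every-disjoint 0F 1F (λ ()) v h , every-disjoint 0F 2F (λ ()) v h ]′ (Equivalence.to T-∨ k))
      regroup : ∀ a b c d e f → a + (b + (c + (d + (e + (f + 0))))) ≡ (a + b) + ((c + d) + (e + f))
      regroup = solve-∀
      regroup′ : ∀ a b c d e f → (a + b) + ((c + d) + (e + f)) ≡ a + (c + (e + (b + (d + f) + 0)))
      regroup′ = solve-∀

  fibration-bound : α IndependenceBoundOf G → (4 * α) IndependenceBoundOf fibration
  fibration-bound bound P ind = ≤-trans (count-layers P ind)
    (+-mono-≤ (s 0F) (+-mono-≤ (s 1F) (+-mono-≤ (s 2F) (+-monoˡ-≤ 0 (bound _ (anyPair-independent P ind))))))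
    where
    s : ∀ p → count (some P ind p) ≤ _
    s p = bound (some P ind p) (some-independent P ind p)

open Fibration using (fibration; fibration-triangleFree; fibration-bound)

point : Graph 1
point = record { _~_ = λ _ _ → ⊥ ; ~-sym = λ () ; ~-irr = λ _ () ; _~?_ = λ _ _ → no λ () }

tower : ∀ j → Graph (6 ^ j)
tower zero    = point
tower (suc j) = fibration (tower j)

tower-triangleFree : ∀ j → TriangleFree (tower j)
tower-triangleFree zero    u v w (() , _)
tower-triangleFree (suc j) = fibration-triangleFree (tower j) (tower-triangleFree j)

tower-bound : ∀ j → (4 ^ j) IndependenceBoundOf tower j
tower-bound zero    P _ with P zero
... | true  = ≤-refl
... | false = z≤n
tower-bound (suc j) = fibration-bound (tower j) (tower-bound j)

-- Extending independent vertices by means of the ECTF property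

-- Spare vertices pad the graph to exactly k + 1 vertices, as IsECTF demands.
data Role (A : Set) : Set where
  old spare : Role A
  new       : A → Role A

-- The greedy step needs a copy of `R` away from the chosen vertices (`joined` false); the final
-- common neighbour is a single point adjacent to all of them (`joined` true).
module Pattern (R : Graph r) (joined : Bool) where
  open Graph R

  infix 4 _⌢_
  _⌢_ : Rel (Role (Fin r)) 0ℓ
  old   ⌢ new _ = T joined
  new _ ⌢ old   = T joined
  new a ⌢ new b = a ~ b
  _     ⌢ _     = ⊥

  ⌢-sym : ∀ {x y} → x ⌢ y → y ⌢ x
  ⌢-sym {old}   {new _} h = h
  ⌢-sym {new _} {old}   h = h
  ⌢-sym {new _} {new _} h = ~-sym h

  ⌢-irr : ∀ x → ¬ (x ⌢ x)
  ⌢-irr (new a) h = ~-irr refl h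

  _⌢?_ : Decidable _⌢_
  old   ⌢? old   = no λ ()
  old   ⌢? spare = no λ ()
  old   ⌢? new _ = T? joined
  spare ⌢? old   = no λ ()
  spare ⌢? spare = no λ ()
  spare ⌢? new _ = no λ ()
  new _ ⌢? old   = T? joined
  new _ ⌢? spare = no λ ()
  new a ⌢? new b = a ~? b

  -- When `joined` is true, an old vertex and an edge of `R` would span a triangle; this is why `R`
  -- must then be edgeless.
  ⌢-triangleFree : TriangleFree R → (T joined → ∀ a b → ¬ (a ~ b)) →
                   ∀ x y z → ¬ (x ⌢ y × y ⌢ z × z ⌢ x)
  ⌢-triangleFree free edgeless old     (new a) (new b) (j , e , _) = edgeless j a b e
  ⌢-triangleFree free edgeless (new a) old     (new b) (j , _ , e) = edgeless j b a e
  ⌢-triangleFree free edgeless (new a) (new b) old     (e , j , _) = edgeless j a b e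
  ⌢-triangleFree free edgeless (new a) (new b) (new c) h           = free a b c h
  ⌢-triangleFree free edgeless (new _) old     old     (_ , () , _)
  ⌢-triangleFree free edgeless (new _) old     spare   (_ , () , _)
  ⌢-triangleFree free edgeless (new _) (new _) spare   (_ , () , _)
  ⌢-triangleFree free edgeless old     (new _) old     (_ , _ , ())
  ⌢-triangleFree free edgeless old     (new _) spare   (_ , () , _)

  role : ∀ i e → Fin (i + (r + e)) → Role (Fin r)
  role i e u = [ (λ _ → old) , (λ w → [ new , (λ _ → spare) ]′ (splitAt r w)) ]′ (splitAt i u)

  role-old : ∀ e (p : Fin i) → role i e (p ↑ˡ (r + e)) ≡ old
  role-old {i} e p rewrite splitAt-↑ˡ i p (r + e) = refl

  role-new : ∀ i e a → role i e (i ↑ʳ (a ↑ˡ e)) ≡ new a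
  role-new i e a rewrite splitAt-↑ʳ i (r + e) (a ↑ˡ e) | splitAt-↑ˡ r a e = refl

  pattern-graph : ∀ i e → Graph (i + (r + e))
  pattern-graph i e = pullback _⌢_ (λ {x} {y} → ⌢-sym {x} {y}) ⌢-irr _⌢?_ (role i e)

record IndependentVertices (G : Graph n) (i : ℕ) : Set where
  open Graph G
  field
    vertex      : Fin i → Fin n
    injective   : ∀ {p q} → vertex p ≡ vertex q → p ≡ q
    independent : ∀ p q → ¬ (vertex p ~ vertex q)

open IndependentVertices

record Extension (G : Graph n) (x : IndependentVertices G i) (R : Graph r) (joined : Bool) : Set where
  open Graph G
  field
    embed     : Fin r → Fin n
    edge      : ∀ a b → Graph._~_ R a b → embed a ~ embed b
    attached  : ∀ p a → T joined ⇔ x .vertex p ~ embed a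
    fresh     : ∀ p a → x .vertex p ≢ embed a

-- The given vertices are the image of the old part under a partial embedding of the padded pattern;
-- extending it places the new part.
ectf-extension : {G : Graph n} → IsECTF k G → {R : Graph r} → TriangleFree R →
                 (joined : Bool) → (T joined → ∀ a b → ¬ Graph._~_ R a b) →
                 (x : IndependentVertices G i) → i + r ≤ suc k → Extension G x R joined
ectf-extension {n = n} {k = k} {r = r} {i = i} {G = G} (_ , extend) {R} free joined edgeless x i+r≤1+k = record
  { embed    = λ a → φ (newᵢ a)
  ; edge     = λ a b e → Equivalence.to (φ-adjacency (newᵢ a) (newᵢ b))
      (subst₂ _⌢_ (sym (role-new i spares a)) (sym (role-new i spares b)) e)
  ; attached = λ p a → subst (_⇔ x .vertex p ~ φ (newᵢ a))
      (cong₂ _⌢_ (role-old spares p) (role-new i spares a))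
      (subst (λ z → H .Graph._~_ (oldᵢ p) (newᵢ a) ⇔ z ~ φ (newᵢ a)) (φ-old p) (φ-adjacency (oldᵢ p) (newᵢ a)))
  ; fresh    = λ p a eq → old≢new p a (φ-injective (trans (φ-old p) eq))
  }
  where
  open Graph G
  open Pattern R joined
  spares : ℕ
  spares = suc k ∸ (i + r)
  H : Graph (i + (r + spares))
  H = pattern-graph i spares
  oldᵢ : Fin i → Fin (i + (r + spares))
  oldᵢ p = p ↑ˡ (r + spares)
  newᵢ : Fin r → Fin (i + (r + spares))
  newᵢ a = i ↑ʳ (a ↑ˡ spares)
  old≢new : ∀ p a → oldᵢ p ≢ newᵢ a
  old≢new p a eq with trans (sym (role-old spares p)) (trans (cong (role i spares) eq) (role-new i spares a))
  ... | ()
  given : Fin (i + (r + spares)) → Maybe (Fin n)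
  given u = [ just ∘ x .vertex , (λ _ → nothing) ]′ (splitAt i u)
  given-old : ∀ p → given (oldᵢ p) ≡ just (x .vertex p)
  given-old p rewrite splitAt-↑ˡ i p (r + spares) = refl
  given⁻¹ : ∀ u {z} → given u ≡ just z → ∃[ p ] u ≡ oldᵢ p × x .vertex p ≡ z
  given⁻¹ u eq with splitAt i u in split
  ... | inj₁ p = p , sym (splitAt⁻¹-↑ˡ split) , just-injective eq
  given⁻¹ u () | inj₂ _
  θ : PartialEmbedding H G
  θ = record
    { to = given
    ; injective = λ {u} {v} hu hv → injective′ u v (given⁻¹ u hu) (given⁻¹ v hv)
    ; adjacency = λ {u} {v} hu hv → adjacency′ u v (given⁻¹ u hu) (given⁻¹ v hv)
    }
    where
    injective′ : ∀ u v {z} → (∃[ p ] u ≡ oldᵢ p × x .vertex p ≡ z) → (∃[ q ] v ≡ oldᵢ q × x .vertex q ≡ z) → u ≡ v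
    injective′ u v (p , refl , eq) (q , refl , eq′) = cong oldᵢ (x .injective (trans eq (sym eq′)))
    adjacency′ : ∀ u v {y z} → (∃[ p ] u ≡ oldᵢ p × x .vertex p ≡ y) → (∃[ q ] v ≡ oldᵢ q × x .vertex q ≡ z) →
                 H .Graph._~_ u v ⇔ y ~ z
    adjacency′ u v (p , refl , refl) (q , refl , refl) = mk⇔
      -- Both sides are empty: old vertices are pairwise non-adjacent in `H`, and their images are
      -- independent in `G`.
      (λ h → ⊥-elim (subst₂ _⌢_ (role-old spares p) (role-old spares q) h))
      (λ h → ⊥-elim (x .independent p q h))
  embedding : Σ (Embedding H G) (_Extends θ)
  -- `extend` speaks of graphs on `suc k` vertices; the equation rewrites this as i + (r + spares).
  embedding = subst
    (λ l → (H : Graph l) → TriangleFree H → (θ : PartialEmbedding H G) → Σ (Embedding H G) (_Extends θ))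
    (trans (sym (m+[n∸m]≡n i+r≤1+k)) (+-assoc i r spares)) extend
    H (λ u v w → ⌢-triangleFree free edgeless (role i spares u) (role i spares v) (role i spares w)) θ
  open Embedding (proj₁ embedding) renaming (to to φ; injective to φ-injective; adjacency to φ-adjacency)
  φ-old : ∀ p → φ (oldᵢ p) ≡ x .vertex p
  φ-old p = proj₂ embedding (given-old p)

-- Greedy choice of independent vertices with few common neighbours

adjacent : (G : Graph n) → Fin n → Fin n → Bool
adjacent G u v = isYes (Graph._~?_ G u v)

-- Count the pairs by their vertex `v` in `S`: the indices `a` with `y a` adjacent to `v` are
-- independent in `R`, since an edge of `R` between two of them would close a triangle with `v`.
double-count : (G : Graph n) → TriangleFree G → {R : Graph r} → α IndependenceBoundOf R →
               (y : Fin r → Fin n) → (∀ a b → Graph._~_ R a b → Graph._~_ G (y a) (y b)) →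
               (S : Fin n → Bool) → sum (λ a → count (λ v → S v ∧ adjacent G (y a) v)) ≤ α * count S
double-count {r = r} {α = α} G free {R} bound y edge S = begin
  sum (λ a → sum λ v → χ (S v ∧ adjacent G (y a) v))  ≡⟨ ∑-comm (λ a v → χ (S v ∧ adjacent G (y a) v)) ⟩
  sum (λ v → sum λ a → χ (S v ∧ adjacent G (y a) v))  ≤⟨ sum-mono (λ v → lemma v (S v)) ⟩
  sum (λ v → α * χ (S v))                             ≡⟨ *-distribˡ-sum α (χ ∘ S) ⟨
  α * count S                                         ∎
  where
  open ≤-Reasoning
  open Graph G
  neighbours-independent : ∀ v → Independent R (λ a → adjacent G (y a) v)
  neighbours-independent v {a} {b} ha hb e =
    free (y a) (y b) v (edge a b e , toWitness hb , ~-sym (toWitness ha))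
  lemma : ∀ v s → sum (λ a → χ (s ∧ adjacent G (y a) v)) ≤ α * χ s
  lemma v true  = subst (_ ≤_) (sym (*-identityʳ α)) (bound _ (neighbours-independent v))
  lemma v false = ≤-reflexive (trans (sum-replicate-zero r) (sym (*-zeroʳ α)))

module Greedy {G : Graph n} (ectf : IsECTF k G) {R : Graph r} .{{_ : NonZero r}}
              (free : TriangleFree R) (bound : α IndependenceBoundOf R) where
  open Graph G

  -- `small` is |common| ≤ (α / r)ⁱ n with denominators cleared; `complete` ensures that a common
  -- neighbour found later is counted in `common`.
  record Stage (i : ℕ) : Set where
    field
      chosen : IndependentVertices G i
      common : Fin n → Bool
      complete : ∀ v → (∀ p → chosen .vertex p ~ v) → T (common v)
      small    : r ^ i * count common ≤ α ^ i * n

  open Stage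

  start : Stage 0
  start = record
    { chosen   = record { vertex = λ () ; injective = λ { {()} } ; independent = λ () }
    ; common   = λ _ → true
    ; complete = λ _ _ → tt
    ; small    = ≤-reflexive (cong (1 *_) (sum-const-1 n))
    }

  step : i + r ≤ suc k → Stage i → Stage (suc i)
  step {i} h stage = record
    { chosen = record
      { vertex      = λ { zero → y ; (suc p) → x .vertex p }
      ; injective   = λ { {zero}  {zero}  _  → refl
                        ; {zero}  {suc q} eq → ⊥-elim (fresh q a (sym eq))
                        ; {suc p} {zero}  eq → ⊥-elim (fresh p a eq)
                        ; {suc p} {suc q} eq → cong suc (x .injective eq) }
      ; independent = λ { zero    zero    → ~-irr refl
                        -- As `joined` is `false` here, `attached` turns an edge into an element of
                        -- the empty type `T false`.
                        ; zero    (suc q) e → Equivalence.from (attached q a) (~-sym e)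
                        ; (suc p) zero    → Equivalence.from (attached p a)
                        ; (suc p) (suc q) → x .independent p q }
      }
    ; common   = λ v → S v ∧ adjacent G y v
    ; complete = λ v all → Equivalence.from T-∧ (stage .complete v (all ∘ suc) , fromWitness (all zero))
    ; small    = shrink
    }
    where
    x = stage .chosen
    S = stage .common
    open Extension (ectf-extension ectf {R} free false (λ ()) x h)
    choice : ∃[ a ] r * count (λ v → S v ∧ adjacent G (embed a) v) ≤ _
    choice = minimum≤average (λ a → count (λ v → S v ∧ adjacent G (embed a) v))
    a : Fin r
    a = proj₁ choice
    y : Fin n
    y = embed a
    shrink : r ^ suc i * count (λ v → S v ∧ adjacent G y v) ≤ α ^ suc i * n
    shrink = begin
      r * r ^ i * count (λ v → S v ∧ adjacent G y v)    ≡⟨ swap r (r ^ i) _ ⟩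
      r ^ i * (r * count (λ v → S v ∧ adjacent G y v))  ≤⟨ *-monoʳ-≤ (r ^ i) (≤-trans (proj₂ choice) (double-count G (proj₁ ectf) {R} bound embed edge S)) ⟩
      r ^ i * (α * count S)                             ≡⟨ swap′ (r ^ i) α _ ⟩
      α * (r ^ i * count S)                             ≤⟨ *-monoʳ-≤ α (stage .small) ⟩
      α * (α ^ i * n)                                   ≡⟨ *-assoc α (α ^ i) n ⟨
      α * α ^ i * n                                     ∎
      where
      open ≤-Reasoning
      swap : ∀ a b c → a * b * c ≡ b * (a * c)
      swap = solve-∀
      swap′ : ∀ a b c → a * (b * c) ≡ b * (a * c)
      swap′ = solve-∀

  stage : ∀ s → s + r ≤ suc k → Stage s
  stage zero    _ = start
  stage (suc s) h = step (<⇒≤ h) (stage s (<⇒≤ h))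

  -- Extend by one vertex joined to all chosen ones: this pattern takes i + 1 ≤ k + 1 vertices, and
  -- its new vertex lands in `common`.
  common-nonempty : i ≤ k → (st : Stage i) → 1 ≤ count (st .common)
  common-nonempty {i} i≤k st = member (st .common) (embed zero)
    (st .complete (embed zero) (λ p → Equivalence.to (attached p zero) tt))
    where
    open Extension (ectf-extension ectf {point} (tower-triangleFree 0) true (λ _ _ _ ()) (st .chosen)
      (subst (_≤ suc k) (+-comm 1 i) (s≤s i≤k)))
    member : ∀ {n} (P : Fin n → Bool) v → T (P v) → 1 ≤ count P
    member P zero    h with true ← P zero = s≤s z≤n
    member P (suc v) h = ≤-trans (member (P ∘ suc) v h) (m≤n+m _ (χ (P zero)))

  order-bound : ∀ s → s + r ≤ suc k → r ^ s ≤ α ^ s * n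
  order-bound s h = ≤-trans
    (m≤m*n (r ^ s) _ {{>-nonZero (common-nonempty s≤k (stage s h))}})
    (stage s h .small)
    where
    s≤k : s ≤ k
    s≤k = +-cancelʳ-≤ 1 s k (≤-trans (+-monoʳ-≤ s (n≢0⇒n>0 (≢-nonZero⁻¹ r))) (subst (s + r ≤_) (+-comm 1 k) h))

ectf-order : ∀ {G : Graph n} j s → s + 6 ^ j ≤ suc k → IsECTF k G → (6 ^ j) ^ s ≤ (4 ^ j) ^ s * n
ectf-order j s h ectf = order-bound s h
  where open Greedy ectf {tower j} {{m^n≢0 6 j}} (tower-triangleFree j) (tower-bound j)

-- Rational estimates for the exponential

private variable
  a b p q u v w : ℚ

ι-+ : ∀ m n → ι (m + n) ≡ ι m ℚ.+ ι n
ι-+ zero    n = sym (ℚₚ.+-identityˡ (ι n))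
ι-+ (suc m) n = begin
  ι (suc (m + n))        ≡⟨ ι-suc (m + n) ⟩
  1ℚ ℚ.+ ι (m + n)       ≡⟨ cong (λ z → 1ℚ ℚ.+ z) (ι-+ m n) ⟩
  1ℚ ℚ.+ (ι m ℚ.+ ι n)   ≡⟨ ℚₚ.+-assoc 1ℚ (ι m) (ι n) ⟨
  (1ℚ ℚ.+ ι m) ℚ.+ ι n   ≡⟨ cong (ℚ._+ ι n) (ι-suc m) ⟨
  ι (suc m) ℚ.+ ι n      ∎
  where open ≡-Reasoning

ι-* : ∀ m n → ι (m * n) ≡ ι m ℚ.* ι n
ι-* zero    n = sym (ℚₚ.*-zeroˡ (ι n))
ι-* (suc m) n = begin
  ι (n + m * n)            ≡⟨ ι-+ n (m * n) ⟩
  ι n ℚ.+ ι (m * n)        ≡⟨ cong (λ z → ι n ℚ.+ z) (ι-* m n) ⟩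
  ι n ℚ.+ ι m ℚ.* ι n      ≡⟨ solve 2 (λ m n → n :+ m :* n := (con 1ℚ :+ m) :* n) refl (ι m) (ι n) ⟩
  (1ℚ ℚ.+ ι m) ℚ.* ι n     ≡⟨ cong (ℚ._* ι n) (ι-suc m) ⟨
  ι (suc m) ℚ.* ι n        ∎
  where open ≡-Reasoning

ι-^ : ∀ m n → ι (m ^ n) ≡ ι m ^ℚ n
ι-^ m zero    = refl
ι-^ m (suc n) = trans (ι-* m (m ^ n)) (cong (ι m ℚ.*_) (ι-^ m n))

<⇒≱ℚ : p ℚ.< q → ¬ (q ℚ.≤ p)
<⇒≱ℚ p<q q≤p = ℚₚ.<-irrefl refl (ℚₚ.<-≤-trans p<q q≤p)

ι-cancel-< : ∀ {m n} → ι m ℚ.< ι n → m < n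
ι-cancel-< h = ≰⇒> λ n≤m → <⇒≱ℚ h (ι-mono n≤m)

^-mono-< : ∀ n → 0ℚ ℚ.≤ a → a ℚ.< b → a ^ℚ suc n ℚ.< b ^ℚ suc n
^-mono-< {a} {b} n 0≤a a<b = ℚₚ.≤-<-trans
  (*-mono≤ 0≤a (^-mono n 0≤a (ℚₚ.<⇒≤ a<b)))
  (*-mono′ (^-0< n (ℚₚ.≤-<-trans 0≤a a<b)) a<b)

-- This encodes log (3/2) > 2/5. Write m for `suc t`: with 20 m factors (`suc d` unfolds to this
-- number) each factor is 1 - 1/50, so the bound is the m-th power of 1 < (3/2)(49/50)²⁰.
exp-[2/5]*< : ∀ t → exp (ι (suc t) ℚ.* (ℤ.+ 2 / 5)) < (ℤ.+ 3 / 2) ^ℚ suc t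
exp-[2/5]*< t = d
  , subst (0ℚ ℚ.<_) (sym factor) (from-yes (0ℚ ℚ.<? ℤ.+ 49 / 50))
  , subst (λ z → 1ℚ ℚ.< (ℤ.+ 3 / 2) ^ℚ suc t ℚ.* z ^ℚ suc d) (sym factor)
      (subst (1ℚ ℚ.<_) power (1<^ t (from-yes (1ℚ ℚ.<? (ℤ.+ 3 / 2) ℚ.* (ℤ.+ 49 / 50) ^ℚ 20))))
  where
  d : ℕ
  d = t + 19 * suc t
  e : ℚ
  e = 1/1+ d
  factor : 1ℚ ℚ.- (ι (suc t) ℚ.* (ℤ.+ 2 / 5)) ℚ.* e ≡ ℤ.+ 49 / 50
  factor = begin
    1ℚ ℚ.- (ι (suc t) ℚ.* (ℤ.+ 2 / 5)) ℚ.* e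
      ≡⟨ solve 2 (λ t e → con 1ℚ :- (t :* con (ℤ.+ 2 / 5)) :* e := con 1ℚ :- con (ℤ.+ 1 / 50) :* ((con (ι 20) :* t) :* e)) refl (ι (suc t)) e ⟩
    1ℚ ℚ.- (ℤ.+ 1 / 50) ℚ.* ((ι 20 ℚ.* ι (suc t)) ℚ.* e)
      ≡⟨ cong (λ z → 1ℚ ℚ.- (ℤ.+ 1 / 50) ℚ.* (z ℚ.* e)) (ι-* 20 (suc t)) ⟨
    1ℚ ℚ.- (ℤ.+ 1 / 50) ℚ.* (ι (suc d) ℚ.* e)
      ≡⟨ cong (λ z → 1ℚ ℚ.- (ℤ.+ 1 / 50) ℚ.* z) (ι*1/1+ d) ⟩
    ℤ.+ 49 / 50 ∎
    where open ≡-Reasoning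
  power : ((ℤ.+ 3 / 2) ℚ.* (ℤ.+ 49 / 50) ^ℚ 20) ^ℚ suc t ≡ (ℤ.+ 3 / 2) ^ℚ suc t ℚ.* (ℤ.+ 49 / 50) ^ℚ suc d
  power = trans (^-distrib-* (ℤ.+ 3 / 2) ((ℤ.+ 49 / 50) ^ℚ 20) (suc t))
    (cong ((ℤ.+ 3 / 2) ^ℚ suc t ℚ.*_) (^-assocʳ (ℤ.+ 49 / 50) 20 (suc t)))

11^<exp-3* : ∀ t → ι (11 ^ suc t) <exp (ι 3 ℚ.* ι (suc t))
11^<exp-3* t = d
  , subst (0ℚ ℚ.<_) (sym factor) (from-yes (0ℚ ℚ.<? ℤ.+ 3 / 2))
  , subst₂ ℚ._<_ (sym (ι-^ 11 (suc t)))
      (trans (^-assocʳ (ℤ.+ 3 / 2) 6 (suc t)) (cong (_^ℚ suc d) (sym factor)))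
      (^-mono-< t (ι-0≤ 11) (from-yes (ι 11 ℚ.<? (ℤ.+ 3 / 2) ^ℚ 6)))
  where
  d : ℕ
  d = t + 5 * suc t
  e : ℚ
  e = 1/1+ d
  factor : 1ℚ ℚ.+ (ι 3 ℚ.* ι (suc t)) ℚ.* e ≡ ℤ.+ 3 / 2
  factor = begin
    1ℚ ℚ.+ (ι 3 ℚ.* ι (suc t)) ℚ.* e
      ≡⟨ solve 2 (λ t e → con 1ℚ :+ (con (ι 3) :* t) :* e := con 1ℚ :+ con ½ :* ((con (ι 6) :* t) :* e)) refl (ι (suc t)) e ⟩
    1ℚ ℚ.+ ½ ℚ.* ((ι 6 ℚ.* ι (suc t)) ℚ.* e)
      ≡⟨ cong (λ z → 1ℚ ℚ.+ ½ ℚ.* (z ℚ.* e)) (ι-* 6 (suc t)) ⟨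
    1ℚ ℚ.+ ½ ℚ.* (ι (suc d) ℚ.* e)
      ≡⟨ cong (λ z → 1ℚ ℚ.+ ½ ℚ.* z) (ι*1/1+ d) ⟩
    ℤ.+ 3 / 2 ∎
    where open ≡-Reasoning

-- Were p ≤ q, then eᵖ ≤ e^q < w ≤ v < eᵖ.
exp-cancel-< : v <exp p → exp q < w → w ℚ.≤ v → q ℚ.< p
exp-cancel-< {v} {p} {q} {w} v<eᵖ e^q<w w≤v = ℚₚ.≰⇒> λ p≤q →
  <⇒≱ℚ (exp-separated {p} {w} {v} v<eᵖ (exp<-closed≤ p≤q)) w≤v
  where
  exp<-closed≤ : p ℚ.≤ q → exp p < w
  exp<-closed≤ p≤q with p ℚ.<? q
  ... | yes p<q = exp<-closed {p} {q} {w} p<q e^q<w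
  ... | no  p≮q = subst (exp_< w) (ℚₚ.≤-antisym (ℚₚ.≮⇒≥ p≮q) p≤q) e^q<w

-- Choice of the tower height and the contradiction for large n

-- With J = 13 + q, raising J by one multiplies the left side by 6 (J + 1) / J, which is below 11.
-- It serves to refute k < 16 · 6ᴶ when 3 (J - 1) < b ≤ 3 J.
exponential-beats-linear : ∀ q → 16 * 6 ^ (13 + q) * (3 * (13 + q)) ≤ 8 * 11 ^ (12 + q)
exponential-beats-linear zero    = from-yes (16 * 6 ^ 13 * (3 * 13) ≤? 8 * 11 ^ 12)
exponential-beats-linear (suc q) = begin
  -- The added term is exactly the slack between the two sides.
  16 * (6 * X) * (3 * (14 + q))                         ≤⟨ m≤m+n _ (48 * X * (59 + 5 * q)) ⟩
  16 * (6 * X) * (3 * (14 + q)) + 48 * X * (59 + 5 * q) ≡⟨ regroup X q ⟩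
  11 * (16 * X * (3 * (13 + q)))                        ≤⟨ *-monoʳ-≤ 11 (exponential-beats-linear q) ⟩
  11 * (8 * 11 ^ (12 + q))                              ≡⟨ swap (11 ^ (12 + q)) ⟩
  8 * (11 * 11 ^ (12 + q))                              ∎
  where
  open ≤-Reasoning
  X : ℕ
  X = 6 ^ (13 + q)
  regroup : ∀ X q → 16 * (6 * X) * (3 * (14 + q)) + 48 * X * (59 + 5 * q) ≡ 11 * (16 * X * (3 * (13 + q)))
  regroup = solve-∀
  swap : ∀ y → 11 * (8 * y) ≡ 8 * (11 * y)
  swap = solve-∀

-- Descending from a crude upper bound finds the least multiple of 3 that is at least `b`, stopping
-- at 36.
bracket : ∀ q → b ℚ.≤ ι 3 ℚ.* ι (12 + q) →
          b ℚ.≤ ι 3 ℚ.* ι 12 ⊎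
          (∃[ q ] ι 3 ℚ.* ι (12 + q) ℚ.< b × b ℚ.≤ ι 3 ℚ.* ι (13 + q))
bracket     zero    h = inj₁ h
bracket {b} (suc q) h with b ℚ.≤? ι 3 ℚ.* ι (12 + q)
... | yes h′ = bracket q h′
... | no  h′ = inj₂ (q , ℚₚ.≰⇒> h′ , h)

≤3*ι : ∀ b → ∃[ q ] b ℚ.≤ ι 3 ℚ.* ι (12 + q)
≤3*ι b = let (q , b<) = archimedean b in q , ℚₚ.≤-trans (ℚₚ.<⇒≤ b<) (ℚₚ.≤-trans
  (ι-mono (s≤s (m≤n+m q 11)))
  (subst (ℚ._≤ ι 3 ℚ.* ι (12 + q)) (ℚₚ.*-identityˡ (ι (12 + q)))
    (*-mono≤′ (ι-0≤ (12 + q)) (from-yes (1ℚ ℚ.≤? ι 3)))))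

-- Here u < log n < a and b < log log n; j + 1 is b / 3 rounded up, but at least 12.
fits : ∀ t → 180 * 6 ^ 12 ≤ t → ι t ℚ.* (ℤ.+ 2 / 5) ℚ.≤ a →
       0ℚ ℚ.< b → exp b < u → u ℚ.< a → ι 8 ℚ.* a ℚ.< ι k ℚ.* b →
       ∃[ j ] b ℚ.≤ ι 3 ℚ.* ι (suc j) × 16 * 6 ^ suc j ≤ k
fits {a} {b} {u} {k} t T≤t t≤a 0<b eᵇ<u u<a 8a<kb = [ small , large ]′ (bracket (proj₁ (≤3*ι b)) (proj₂ (≤3*ι b)))
  where
  open ℚₚ.≤-Reasoning
  below : ∀ K j → k ≤ K → b ℚ.≤ ι 3 ℚ.* ι j → ι 8 ℚ.* a ℚ.< ι (K * (3 * j))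
  below K j k≤K b≤ = begin-strict
    ι 8 ℚ.* a              <⟨ 8a<kb ⟩
    ι k ℚ.* b              ≤⟨ *-mono≤′ (ℚₚ.<⇒≤ 0<b) (ι-mono k≤K) ⟩
    ι K ℚ.* b              ≤⟨ *-mono≤ (ι-0≤ K) b≤ ⟩
    ι K ℚ.* (ι 3 ℚ.* ι j)  ≡⟨ cong (ι K ℚ.*_) (ι-* 3 j) ⟨
    ι K ℚ.* ι (3 * j)      ≡⟨ ι-* K (3 * j) ⟨
    ι (K * (3 * j))        ∎
  small : b ℚ.≤ ι 3 ℚ.* ι 12 → ∃[ j ] b ℚ.≤ ι 3 ℚ.* ι (suc j) × 16 * 6 ^ suc j ≤ k
  small b≤ = 11 , b≤ , ≮⇒≥ λ k<K → <⇒≱ℚ (below (16 * 6 ^ 12) 12 (<⇒≤ k<K) b≤) (begin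
    -- The threshold 180 · 6¹² for `t` comes from here: 8 · 180 · 2/5 = 16 · 3 · 12.
    ι (16 * 6 ^ 12 * (3 * 12))                  ≡⟨ scale ⟩
    ι 8 ℚ.* (ι (180 * 6 ^ 12) ℚ.* (ℤ.+ 2 / 5))  ≤⟨ *-mono≤ (ι-0≤ 8) (*-mono≤′ (from-yes (0ℚ ℚ.≤? ℤ.+ 2 / 5)) (ι-mono T≤t)) ⟩
    ι 8 ℚ.* (ι t ℚ.* (ℤ.+ 2 / 5))               ≤⟨ *-mono≤ (ι-0≤ 8) t≤a ⟩
    ι 8 ℚ.* a                                   ∎)
    where
    scale : ι (16 * 6 ^ 12 * (3 * 12)) ≡ ι 8 ℚ.* (ι (180 * 6 ^ 12) ℚ.* (ℤ.+ 2 / 5))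
    scale = refl
  large : (∃[ q ] ι 3 ℚ.* ι (12 + q) ℚ.< b × b ℚ.≤ ι 3 ℚ.* ι (13 + q)) →
          ∃[ j ] b ℚ.≤ ι 3 ℚ.* ι (suc j) × 16 * 6 ^ suc j ≤ k
  large (q , <b , b≤) = 12 + q , b≤ , ≮⇒≥ λ k<K → ≤⇒≯ (exponential-beats-linear q) (ι-cancel-< (begin-strict
    ι (8 * 11 ^ (12 + q))                    ≡⟨ ι-* 8 (11 ^ (12 + q)) ⟩
    ι 8 ℚ.* ι (11 ^ (12 + q))                <⟨ *-mono (ι-0< 7) (ℚₚ.<-trans 11^<u u<a) ⟩
    ι 8 ℚ.* a                                <⟨ below (16 * 6 ^ (13 + q)) (13 + q) (<⇒≤ k<K) b≤ ⟩
    ι (16 * 6 ^ (13 + q) * (3 * (13 + q)))   ∎))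
    where
    -- 11^(12 + q) < e^(3 (12 + q)) < eᵇ < u.
    11^<u : ι (11 ^ (12 + q)) ℚ.< u
    11^<u = exp-separated {b} {u} {ι (11 ^ (12 + q))}
      (<exp-closed {ι 3 ℚ.* ι (12 + q)} {b} <b (11^<exp-3* (11 + q))) eᵇ<u

-- Take s = k - 6ᴶ, so that k ≤ (16/15) s. Then 8 a < k b ≤ 3 J k gives a < (3/8)(16/15) J s = (2/5)
-- J s, whence n < eᵃ < (3/2)^(J s), against the order bound.
too-large : ∀ j → b ℚ.≤ ι 3 ℚ.* ι (suc j) → 16 * 6 ^ suc j ≤ k → ι 8 ℚ.* a ℚ.< ι k ℚ.* b →
            v <exp a → ι n ℚ.< v → ¬ HasECTF k n
too-large {b} {k} {a} {v} {n} j b≤ fit 8a<kb v<eᵃ n<v (G , ectf) = contra (k ∸ 6 ^ suc j) (m∸n+n≡m 6^≤k)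
  where
  J : ℕ
  J = suc j
  6^≤k : 6 ^ J ≤ k
  6^≤k = ≤-trans (m≤n*m (6 ^ J) 16) fit
  contra : ∀ s → s + 6 ^ J ≡ k → ⊥
  -- Here k = 6ᴶ, which is smaller than 16 · 6ᴶ.
  contra zero    refl = <⇒≱ (subst (6 ^ J <_) (*-comm (6 ^ J) 16) (m<m*n (6 ^ J) 16 {{m^n≢0 6 J}} (s≤s (s≤s z≤n)))) fit
  contra s@(suc s′) s+6^J≡k = <⇒≱ℚ 4^*n<6^ 6^≤4^*n
    where
    t : ℕ
    t = J * s
    15k≤16s : 15 * k ≤ 16 * s
    15k≤16s = +-cancelʳ-≤ (16 * 6 ^ J) (15 * k) (16 * s) (begin
      15 * k + 16 * 6 ^ J      ≤⟨ +-monoʳ-≤ (15 * k) fit ⟩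
      15 * k + k               ≡⟨ +-comm (15 * k) k ⟩
      16 * k                   ≡⟨ cong (16 *_) s+6^J≡k ⟨
      16 * (s + 6 ^ J)         ≡⟨ *-distribˡ-+ 16 s (6 ^ J) ⟩
      16 * s + 16 * 6 ^ J      ∎)
      where open ≤-Reasoning
    a< : a ℚ.< ι t ℚ.* (ℤ.+ 2 / 5)
    -- The difference is a combination of the gaps in 8 a < k b, b ≤ 3 J and 15 k ≤ 16 s, with
    -- weights chosen so that the terms k b and J k cancel.
    a< = by {d = ℤ.+ 1 / 8 ℚ.* (ι k ℚ.* b ℚ.- ι 8 ℚ.* a) ℚ.+
                 (ℤ.+ 1 / 8 ℚ.* (ι k ℚ.* (ι 3 ℚ.* ι J ℚ.- b)) ℚ.+ ℤ.+ 1 / 40 ℚ.* (ι J ℚ.* (ι 16 ℚ.* ι s ℚ.- ι 15 ℚ.* ι k)))}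
      (ℚₚ.+-mono-<-≤ (0<* (from-yes (0ℚ ℚ.<? ℤ.+ 1 / 8)) (diff 8a<kb))
        (0≤+ (0≤* (from-yes (0ℚ ℚ.≤? ℤ.+ 1 / 8)) (0≤* (ι-0≤ k) (diff≤ b≤)))
             (0≤* (from-yes (0ℚ ℚ.≤? ℤ.+ 1 / 40)) (0≤* (ι-0≤ J) (diff≤ (subst₂ ℚ._≤_ (ι-* 15 k) (ι-* 16 s) (ι-mono 15k≤16s)))))))
      (trans (cong (ℚ._* (ℤ.+ 2 / 5)) (ι-* J s))
        (solve 5 (λ J s k a b → (J :* s) :* con (ℤ.+ 2 / 5) :=
           a :+ (con (ℤ.+ 1 / 8) :* (k :* b :- con (ι 8) :* a) :+
                 (con (ℤ.+ 1 / 8) :* (k :* (con (ι 3) :* J :- b)) :+ con (ℤ.+ 1 / 40) :* (J :* (con (ι 16) :* s :- con (ι 15) :* k)))))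
          refl (ι J) (ι s) (ι k) a b))
    n<[3/2]^t : ι n ℚ.< (ℤ.+ 3 / 2) ^ℚ t
    n<[3/2]^t = ℚₚ.<-trans n<v (exp-separated {a} {(ℤ.+ 3 / 2) ^ℚ t} {v} v<eᵃ
      (exp<-closed {a} {ι t ℚ.* (ℤ.+ 2 / 5)} {(ℤ.+ 3 / 2) ^ℚ t} a< (exp-[2/5]*< (s′ + j * s))))
    6^≤4^*n : ι (6 ^ t) ℚ.≤ ι (4 ^ t) ℚ.* ι n
    6^≤4^*n = subst (ι (6 ^ t) ℚ.≤_) (ι-* (4 ^ t) n) (ι-mono
      (subst₂ (λ x y → x ≤ y * n) (^-*-assoc 6 J s) (^-*-assoc 4 J s)
        (ectf-order J s (subst (_≤ suc k) (sym s+6^J≡k) (n≤1+n k)) ectf)))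
    4^*n<6^ : ι (4 ^ t) ℚ.* ι n ℚ.< ι (6 ^ t)
    4^*n<6^ = subst (ι (4 ^ t) ℚ.* ι n ℚ.<_) (begin
      ι (4 ^ t) ℚ.* (ℤ.+ 3 / 2) ^ℚ t   ≡⟨ cong (ℚ._* (ℤ.+ 3 / 2) ^ℚ t) (ι-^ 4 t) ⟩
      ι 4 ^ℚ t ℚ.* (ℤ.+ 3 / 2) ^ℚ t    ≡⟨ ^-distrib-* (ι 4) (ℤ.+ 3 / 2) t ⟨
      ι 6 ^ℚ t                         ≡⟨ ι-^ 6 t ⟨
      ι (6 ^ t)                        ∎)
      (*-mono (subst (0ℚ ℚ.<_) (sym (ι-^ 4 t)) (^-0< t (ι-0< 3))) n<[3/2]^t)
      where open ≡-Reasoning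

-- e^((2/5)(t + 1)) < (3/2)^(t + 1) ≤ 2^(t + 1) ≤ n < eᵃ. The exponent is t + 1 because the estimate
-- for 3/2 covers positive powers; the result is then weakened to t.
ln-large : ∀ t → 2 ^ suc t ≤ n → v <exp a → ι n ℚ.< v → ι t ℚ.* (ℤ.+ 2 / 5) ℚ.≤ a
ln-large {n} {v} {a} t 2^≤n v<eᵃ n<v = ℚₚ.≤-trans
  (*-mono≤′ (from-yes (0ℚ ℚ.≤? ℤ.+ 2 / 5)) (ι-mono (n≤1+n t)))
  (ℚₚ.<⇒≤ (exp-cancel-< {v} {a} {ι (suc t) ℚ.* (ℤ.+ 2 / 5)} v<eᵃ (exp-[2/5]*< t) (begin
    (ℤ.+ 3 / 2) ^ℚ suc t  ≤⟨ ^-mono (suc t) (from-yes (0ℚ ℚ.≤? ℤ.+ 3 / 2)) (from-yes (ℤ.+ 3 / 2 ℚ.≤? ι 2)) ⟩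
    ι 2 ^ℚ suc t          ≡⟨ ι-^ 2 (suc t) ⟨
    ι (2 ^ suc t)         ≤⟨ ι-mono 2^≤n ⟩
    ι n                   ≤⟨ ℚₚ.<⇒≤ n<v ⟩
    v                     ∎)))
  where open ℚₚ.≤-Reasoning

no-ectf : ∀ t → 180 * 6 ^ 12 ≤ t → ∃[ n₀ ] ∀ n → n₀ ≤ n → (3≤n : 3 ≤ n) → ∀ k →
          ((ι 8 · ln n 3≤n) ÷ᴿ lnln n 3≤n ⟨ 0<lnln n 3≤n ⟩) <ᴿ fromℕ k → ¬ HasECTF k n
no-ectf t T≤t = 2 ^ suc t , λ
  -- The cuts unfold to rationals: b < log log n through eᵇ < u and eᵘ < w < n, and log n < a
  -- through n < v < eᵃ, with q b = 8 a and q < k.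
  n 2^≤n 3≤n k (q , (b , _ , 0<b , (u , (w , w<n , eᵘ<w) , eᵇ<u) , _ , (a , (v , n<v , v<eᵃ) , qb≡8a) , _) , q<k) →
  let 8a<kb          = subst (ℚ._< ι k ℚ.* b) qb≡8a (*-mono′ 0<b q<k)
      u<a            = exp-cancel-< {v} {a} {u} v<eᵃ eᵘ<w (ℚₚ.<⇒≤ (ℚₚ.<-trans w<n n<v))
      (j , b≤ , fit) = fits {k = k} t T≤t (ln-large {a = a} t 2^≤n v<eᵃ n<v) 0<b eᵇ<u u<a 8a<kb
  in too-large {a = a} j b≤ fit 8a<kb v<eᵃ n<v

-- Opaque because n₀, a power of 2 with more than 10¹¹ digits, must not be evaluated.
abstract
  no-ectf-eventually : ∃[ n₀ ] ∀ n → n₀ ≤ n → (3≤n : 3 ≤ n) → ∀ k →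
    ((ι 8 · ln n 3≤n) ÷ᴿ lnln n 3≤n ⟨ 0<lnln n 3≤n ⟩) <ᴿ fromℕ k → ¬ HasECTF k n
  no-ectf-eventually = no-ectf (180 * 6 ^ 12) ≤-refl

-- This moves the constant 8 from outside the quotient to inside. The interval around the divisor is
-- kept: if q = 8 a, then q x = 8 (a x) at both of its ends.
·-÷<⇒÷< : ∀ n (3≤n : 3 ≤ n) k →
  ((ι 8 · (ln n 3≤n ÷ᴿ lnln n 3≤n ⟨ 0<lnln n 3≤n ⟩)) <ᴿ fromℕ k) →
  ((ι 8 · ln n 3≤n) ÷ᴿ lnln n 3≤n ⟨ 0<lnln n 3≤n ⟩) <ᴿ fromℕ k
·-÷<⇒÷< n 3≤n k (q , (a , (b , c , 0<b , lb , uc , h , h′) , q≡8a) , q<k) =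
  q , (b , c , 0<b , lb , uc , (a ℚ.* b , h , scale b) , (a ℚ.* c , h′ , scale c)) , q<k
  where
  scale : ∀ x → q ℚ.* x ≡ ι 8 ℚ.* (a ℚ.* x)
  scale x = trans (cong (ℚ._* x) q≡8a) (ℚₚ.*-assoc (ι 8) a x)

theorem1 : (∃[ n₀ ] ∀ n → n₀ ≤ n → (3≤n : 3 ≤ n) → ∀ k →
    ((ι 8 · ln n 3≤n) ÷ᴿ lnln n 3≤n ⟨ 0<lnln n 3≤n ⟩) <ᴿ fromℕ k →
    ¬ HasECTF k n)
    ×
    (Σ ℚ λ C → Σ (Positive C) λ C>0 → ∃[ n₁ ] ∀ n → n₁ ≤ n → (3≤n : 3 ≤ n) → ∀ k →
    IsLargestECTF k n →
    fromℕ k ≤ᴿ (_·_ C {{C>0}} (ln n 3≤n ÷ᴿ lnln n 3≤n ⟨ 0<lnln n 3≤n ⟩)))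
theorem1 =
  let (n₀ , no-ectf-from-n₀) = no-ectf-eventually in
  (n₀ , no-ectf-from-n₀) ,
  -- C = 8 works from the same n₀ on: `_≤ᴿ_` is a negated strict inequality, and the first part
  -- refutes that inequality for the graph attaining f(n).
  (ι 8 , _ , n₀ , λ n n₀≤n 3≤n k (_ , ectf , _) 8·<k →
    no-ectf-from-n₀ n n₀≤n 3≤n k (·-÷<⇒÷< n 3≤n k 8·<k) ectf)
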